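{- Let $\tau$ be an arithmetic signature. Then for every $\tau$-formula $\phi$ in negation normal form, which may contain both weak existential and weak universal quantifiers, there is a $\tau$-formula $\phi'$ such that (1) $\phi'$ is equivalent to $\phi$ on finite structures, (2) $\mathrm{qr}(\phi') = 3\cdot \mathrm{strong\text{ - }qr}(\phi) + O(\mathrm{arity}(\tau))$, and (3) $|\mathrm{bound}(\phi')| = |\mathrm{strong\text{ - }bound}(\phi)| + O(\mathrm{arity}(\tau))$, where neither weak existential nor weak universal quantifiers count towards $\mathrm{strong\text{ - }qr}(\phi)$, and variables bound by them do not belong to $\mathrm{strong\text{ - }bound}(\phi)$.
   Context: A signature $\tau$ is arithmetic if it contains $<$, ternary $\mathrm{add}$, ternary $\mathrm{mult}$, unary function $\mathrm{succ}$ and constant $0$; $\mathrm{STRUC}[\tau]$ contains only finite $\tau$-structures in which $<$ is a linear order and $\mathrm{add},\mathrm{mult},\mathrm{succ},0$ have their natural meaning relative to it. $\mathrm{arity}(\tau)$ is the maximum arity of a relation symbol in $\tau$. Negation normal form: negations only applied to atoms; $x\neq y$ abbreviates $\neg\, x=y$. For a subformula $\forall d(\psi)$ or $\exists d(\psi)$, $d$ depends on all variables free in $\psi$. The leading quantifier of $\exists x(\psi)$ is weak unless (i) some universal quantifier binding inside $\psi$ depends on $x$, or (ii) there is a subformula $\alpha\land\beta$ of $\psi$ with both $\alpha$ and $\beta$ containing $x$ in literals not of the form $x\neq y$ for a variable $y$. Dually, the leading quantifier of $\forall x(\psi)$ is weak if no existential quantifier binding inside $\psi$ depends on $x$ and for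 every subformula $\alpha\lor\beta$ of $\psi$ at most one of $\alpha,\beta$ contains a literal that contains $x$ and is not of the form $x = y$ for a variable $y$. Quantifiers that are not weak are strong. $\mathrm{qr}$ is quantifier rank, $\mathrm{bound}(\phi)$ the set of bound variables, $\mathrm{strong\text{ - }qr}(\phi)$ the quantifier rank ignoring weak quantifiers, $\mathrm{strong\text{ - }bound}(\phi)$ the set of variables bound by strong quantifiers. $O(\mathrm{arity}(\tau))$ denotes a quantity bounded by $c\cdot\mathrm{arity}(\tau)+c$ for an absolute constant $c$. -}

module Defs where

open import Data.Nat using (ℕ; suc; s≤s; _+_; _*_; _⊔_; _⊓_; _<_; _≟_)
open import Data.Bool using (Bool; T; if_then_else_)
open import Data.Empty using (⊥)
open import Data.Fin using (Fin; toℕ; fromℕ<; zero)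
open import Data.List using (List; []; _∷_; [_]; _++_; length; lookup; filter; deduplicate)
open import Data.List.Extrema.Nat using (max)
open import Data.List.Membership.DecPropositional _≟_ using (_∈?_)
open import Data.List.Membership.Propositional using (_∈_)
open import Data.List.Relation.Unary.Any using (Any; any?)
open import Data.Nat.Properties using (m⊓n≤n)
open import Data.Product using (Σ-syntax; _×_)
open import Data.Sum using (_⊎_)
open import Data.Vec using (Vec; []; _∷_; map; foldr)
open import Function.Bundles using (_↔_; _⇔_; Inverse)
open import Relation.Binary.PropositionalEquality using (_≡_)
open import Relation.Nullary using (¬_; Dec; no; does)
open import Relation.Nullary.Decidable using (¬?; _×-dec_; _⊎-dec_)

-- An arithmetic signature: the symbols <, add, mult, succ and 0 are always
-- present, and there are finitely many further relation symbols (given by the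
-- list of their arities) and constant symbols.  The only function symbol is succ.

record Signature : Set where
  field
    relArities : List ℕ
    constants  : ℕ

open Signature public

data RelSym (τ : Signature) : ℕ → Set where
  lt    : RelSym τ 2
  add   : RelSym τ 3
  mult  : RelSym τ 3
  other : (i : Fin (length (relArities τ))) → RelSym τ (lookup (relArities τ) i)

data ConstSym (τ : Signature) : Set where
  zero  : ConstSym τ
  other : Fin (constants τ) → ConstSym τ

-- The 3 accounts for add and mult.
arity : Signature → ℕ
arity τ = max 3 (relArities τ)

-- Variables are named, because bound and strong-bound count variable names:
-- one name may be bound by several quantifiers.

Var : Set
Var = ℕ

data Term (τ : Signature) : Set where
  var   : Var → Term τ
  const : ConstSym τ → Term τ
  succ  : Term τ → Term τ

data Atom (τ : Signature) : Set where
  rel : ∀ {k} → RelSym τ k → Vec (Term τ) k → Atom τ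
  _≐_ : Term τ → Term τ → Atom τ

infix  9 ¬ᶠ_
infixr 7 _∧ᶠ_
infixr 6 _∨ᶠ_

data Formula (τ : Signature) : Set where
  atom      : Atom τ → Formula τ
  ¬ᶠ_       : Formula τ → Formula τ
  _∧ᶠ_ _∨ᶠ_ : Formula τ → Formula τ → Formula τ
  ∃ᶠ ∀ᶠ     : Var → Formula τ → Formula τ

data NNF {τ : Signature} : Formula τ → Set where
  pos  : ∀ a → NNF (atom a)
  neg  : ∀ a → NNF (¬ᶠ atom a)
  _∧ᶠ_ : ∀ {φ ψ} → NNF φ → NNF ψ → NNF (φ ∧ᶠ ψ)
  _∨ᶠ_ : ∀ {φ ψ} → NNF φ → NNF ψ → NNF (φ ∨ᶠ ψ)
  ∃ᶠ   : ∀ x {φ} → NNF φ → NNF (∃ᶠ x φ)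
  ∀ᶠ   : ∀ x {φ} → NNF φ → NNF (∀ᶠ x φ)

-- STRUC[τ].  A linear order on a finite nonempty set is the same thing as a
-- bijection with {0, …, last}; the arithmetic symbols are then interpreted
-- through the positions, and only the remaining symbols are free.

record Structure (τ : Signature) : Set₁ where
  field
    Universe : Set
    last     : ℕ
    position : Universe ↔ Fin (suc last)
    relation : (i : Fin (length (relArities τ))) →
               Vec Universe (lookup (relArities τ) i) → Bool
    constant : Fin (constants τ) → Universe

  rank : Universe → ℕ
  rank a = toℕ (Inverse.to position a)

  -- The last element is its own successor.
  next : Universe → Universe
  next a = Inverse.from position (fromℕ< (s≤s (m⊓n≤n (suc (rank a)) last)))

  ⟦_⟧ᶜ : ConstSym τ → Universe
  ⟦ zero ⟧ᶜ    = Inverse.from position zero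
  ⟦ other i ⟧ᶜ = constant i

  ⟦_⟧ʳ : ∀ {k} → RelSym τ k → Vec Universe k → Set
  ⟦ lt ⟧ʳ      (a ∷ b ∷ [])     = rank a < rank b
  ⟦ add ⟧ʳ     (a ∷ b ∷ c ∷ []) = rank a + rank b ≡ rank c
  ⟦ mult ⟧ʳ    (a ∷ b ∷ c ∷ []) = rank a * rank b ≡ rank c
  ⟦ other i ⟧ʳ as               = T (relation i as)

module _ {τ : Signature} (A : Structure τ) where
  open Structure A

  Assignment : Set
  Assignment = Var → Universe

  _[_↦_] : Assignment → Var → Universe → Assignment
  (s [ x ↦ a ]) y = if does (x ≟ y) then a else s y

  ⟦_⟧ : Term τ → Assignment → Universe
  ⟦ var x ⟧   s = s x
  ⟦ const c ⟧ s = ⟦ c ⟧ᶜ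
  ⟦ succ t ⟧  s = next (⟦ t ⟧ s)

  Holds : Atom τ → Assignment → Set
  Holds (rel R ts) s = ⟦ R ⟧ʳ (map (λ t → ⟦ t ⟧ s) ts)
  Holds (t ≐ u)    s = ⟦ t ⟧ s ≡ ⟦ u ⟧ s

  _⊨_ : Assignment → Formula τ → Set
  s ⊨ atom a   = Holds a s
  s ⊨ (¬ᶠ φ)   = ¬ (s ⊨ φ)
  s ⊨ (φ ∧ᶠ ψ) = (s ⊨ φ) × (s ⊨ ψ)
  s ⊨ (φ ∨ᶠ ψ) = (s ⊨ φ) ⊎ (s ⊨ ψ)
  s ⊨ ∃ᶠ x φ   = Σ[ a ∈ Universe ] ((s [ x ↦ a ]) ⊨ φ)
  s ⊨ ∀ᶠ x φ   = (a : Universe) → (s [ x ↦ a ]) ⊨ φ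

Equivalent : ∀ {τ} → Formula τ → Formula τ → Set₁
Equivalent {τ} φ ψ =
  (A : Structure τ) (s : Assignment A) → (_⊨_ A s φ) ⇔ (_⊨_ A s ψ)

-- Finite sets of variables are represented by lists, possibly with repetitions.

∣_∣ : List Var → ℕ
∣ xs ∣ = length (deduplicate _≟_ xs)

termVars : ∀ {τ} → Term τ → List Var
termVars (var x)   = [ x ]
termVars (const c) = []
termVars (succ t)  = termVars t

atomVars : ∀ {τ} → Atom τ → List Var
atomVars (rel R ts) = foldr _ (λ t xs → termVars t ++ xs) [] ts
atomVars (t ≐ u)    = termVars t ++ termVars u

module _ {τ : Signature} where

  free : Formula τ → List Var
  free (atom a) = atomVars a
  free (¬ᶠ φ)   = free φ
  free (φ ∧ᶠ ψ) = free φ ++ free ψ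
  free (φ ∨ᶠ ψ) = free φ ++ free ψ
  free (∃ᶠ x φ) = filter (λ y → ¬? (y ≟ x)) (free φ)
  free (∀ᶠ x φ) = filter (λ y → ¬? (y ≟ x)) (free φ)

  bound : Formula τ → List Var
  bound (atom a) = []
  bound (¬ᶠ φ)   = bound φ
  bound (φ ∧ᶠ ψ) = bound φ ++ bound ψ
  bound (φ ∨ᶠ ψ) = bound φ ++ bound ψ
  bound (∃ᶠ x φ) = x ∷ bound φ
  bound (∀ᶠ x φ) = x ∷ bound φ

  qr : Formula τ → ℕ
  qr (atom a) = 0
  qr (¬ᶠ φ)   = qr φ
  qr (φ ∧ᶠ ψ) = qr φ ⊔ qr ψ
  qr (φ ∨ᶠ ψ) = qr φ ⊔ qr ψ
  qr (∃ᶠ x φ) = suc (qr φ)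
  qr (∀ᶠ x φ) = suc (qr φ)

  -- The subformulas of ψ in which a free x still refers to the x of a
  -- quantifier placed in front of ψ, that is, those that are not in the scope
  -- of another quantifier binding the same name.  A negation is a leaf, because
  -- in negation normal form it is a literal: x ≠ y must not contribute x = y.
  scope : Var → Formula τ → List (Formula τ)
  scope x φ@(atom _)   = [ φ ]
  scope x φ@(¬ᶠ _)     = [ φ ]
  scope x φ@(α ∧ᶠ β)   = φ ∷ scope x α ++ scope x β
  scope x φ@(α ∨ᶠ β)   = φ ∷ scope x α ++ scope x β
  scope x φ@(∃ᶠ y ψ)   = φ ∷ (if does (x ≟ y) then [] else scope x ψ)
  scope x φ@(∀ᶠ y ψ)   = φ ∷ (if does (x ≟ y) then [] else scope x ψ)

  -- The atom is x = y or y = x for a variable y; as in x ≠ y below, the order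
  -- of the two sides is immaterial.
  VarEquation : Var → Atom τ → Set
  VarEquation x (var y ≐ var z) = x ≡ y ⊎ x ≡ z
  VarEquation x _               = ⊥

  -- Literals that contain x and are not of the form x ≠ y.
  ∃-Essential : Var → Formula τ → Set
  ∃-Essential x (atom a)        = x ∈ atomVars a
  ∃-Essential x (¬ᶠ (atom a))   = x ∈ atomVars a × ¬ VarEquation x a
  ∃-Essential x _               = ⊥

  -- Literals that contain x and are not of the form x = y.
  ∀-Essential : Var → Formula τ → Set
  ∀-Essential x (atom a)        = x ∈ atomVars a × ¬ VarEquation x a
  ∀-Essential x (¬ᶠ (atom a))   = x ∈ atomVars a
  ∀-Essential x _               = ⊥

  DependentUniversal : Var → Formula τ → Set
  DependentUniversal x φ@(∀ᶠ _ _) = x ∈ free φ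
  DependentUniversal x _          = ⊥

  DependentExistential : Var → Formula τ → Set
  DependentExistential x φ@(∃ᶠ _ _) = x ∈ free φ
  DependentExistential x _          = ⊥

  SharedConjunction : Var → Formula τ → Set
  SharedConjunction x (α ∧ᶠ β) =
    Any (∃-Essential x) (scope x α) × Any (∃-Essential x) (scope x β)
  SharedConjunction x _        = ⊥

  SharedDisjunction : Var → Formula τ → Set
  SharedDisjunction x (α ∨ᶠ β) =
    Any (∀-Essential x) (scope x α) × Any (∀-Essential x) (scope x β)
  SharedDisjunction x _        = ⊥

  -- The leading quantifier of ∃ᶠ x ψ, respectively ∀ᶠ x ψ, is weak.

  Weak∃ : Var → Formula τ → Set
  Weak∃ x ψ = ¬ (Any (DependentUniversal x) (scope x ψ)
               ⊎ Any (SharedConjunction x) (scope x ψ))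

  Weak∀ : Var → Formula τ → Set
  Weak∀ x ψ = ¬ Any (DependentExistential x) (scope x ψ)
            × ¬ Any (SharedDisjunction x) (scope x ψ)

  varEquation? : ∀ x a → Dec (VarEquation x a)
  varEquation? x (rel _ _)             = no λ ()
  varEquation? x (var y ≐ var z)       = (x ≟ y) ⊎-dec (x ≟ z)
  varEquation? x (var _ ≐ const _)     = no λ ()
  varEquation? x (var _ ≐ succ _)      = no λ ()
  varEquation? x (const _ ≐ _)         = no λ ()
  varEquation? x (succ _ ≐ _)          = no λ ()

  ∃-essential? : ∀ x φ → Dec (∃-Essential x φ)
  ∃-essential? x (atom a)            = x ∈? atomVars a
  ∃-essential? x (¬ᶠ (atom a))       = (x ∈? atomVars a) ×-dec ¬? (varEquation? x a)
  ∃-essential? x (¬ᶠ (¬ᶠ _))         = no λ ()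
  ∃-essential? x (¬ᶠ (_ ∧ᶠ _))       = no λ ()
  ∃-essential? x (¬ᶠ (_ ∨ᶠ _))       = no λ ()
  ∃-essential? x (¬ᶠ (∃ᶠ _ _))       = no λ ()
  ∃-essential? x (¬ᶠ (∀ᶠ _ _))       = no λ ()
  ∃-essential? x (_ ∧ᶠ _)            = no λ ()
  ∃-essential? x (_ ∨ᶠ _)            = no λ ()
  ∃-essential? x (∃ᶠ _ _)            = no λ ()
  ∃-essential? x (∀ᶠ _ _)            = no λ ()

  ∀-essential? : ∀ x φ → Dec (∀-Essential x φ)
  ∀-essential? x (atom a)            = (x ∈? atomVars a) ×-dec ¬? (varEquation? x a)
  ∀-essential? x (¬ᶠ (atom a))       = x ∈? atomVars a
  ∀-essential? x (¬ᶠ (¬ᶠ _))         = no λ ()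
  ∀-essential? x (¬ᶠ (_ ∧ᶠ _))       = no λ ()
  ∀-essential? x (¬ᶠ (_ ∨ᶠ _))       = no λ ()
  ∀-essential? x (¬ᶠ (∃ᶠ _ _))       = no λ ()
  ∀-essential? x (¬ᶠ (∀ᶠ _ _))       = no λ ()
  ∀-essential? x (_ ∧ᶠ _)            = no λ ()
  ∀-essential? x (_ ∨ᶠ _)            = no λ ()
  ∀-essential? x (∃ᶠ _ _)            = no λ ()
  ∀-essential? x (∀ᶠ _ _)            = no λ ()

  dependentUniversal? : ∀ x φ → Dec (DependentUniversal x φ)
  dependentUniversal? x (atom _)     = no λ ()
  dependentUniversal? x (¬ᶠ _)       = no λ ()
  dependentUniversal? x (_ ∧ᶠ _)     = no λ ()
  dependentUniversal? x (_ ∨ᶠ _)     = no λ ()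
  dependentUniversal? x (∃ᶠ _ _)     = no λ ()
  dependentUniversal? x φ@(∀ᶠ _ _)   = x ∈? free φ

  dependentExistential? : ∀ x φ → Dec (DependentExistential x φ)
  dependentExistential? x (atom _)   = no λ ()
  dependentExistential? x (¬ᶠ _)     = no λ ()
  dependentExistential? x (_ ∧ᶠ _)   = no λ ()
  dependentExistential? x (_ ∨ᶠ _)   = no λ ()
  dependentExistential? x φ@(∃ᶠ _ _) = x ∈? free φ
  dependentExistential? x (∀ᶠ _ _)   = no λ ()

  sharedConjunction? : ∀ x φ → Dec (SharedConjunction x φ)
  sharedConjunction? x (atom _)      = no λ ()
  sharedConjunction? x (¬ᶠ _)        = no λ ()
  sharedConjunction? x (α ∧ᶠ β)      =
    any? (∃-essential? x) (scope x α) ×-dec any? (∃-essential? x) (scope x β)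
  sharedConjunction? x (_ ∨ᶠ _)      = no λ ()
  sharedConjunction? x (∃ᶠ _ _)      = no λ ()
  sharedConjunction? x (∀ᶠ _ _)      = no λ ()

  sharedDisjunction? : ∀ x φ → Dec (SharedDisjunction x φ)
  sharedDisjunction? x (atom _)      = no λ ()
  sharedDisjunction? x (¬ᶠ _)        = no λ ()
  sharedDisjunction? x (_ ∧ᶠ _)      = no λ ()
  sharedDisjunction? x (α ∨ᶠ β)      =
    any? (∀-essential? x) (scope x α) ×-dec any? (∀-essential? x) (scope x β)
  sharedDisjunction? x (∃ᶠ _ _)      = no λ ()
  sharedDisjunction? x (∀ᶠ _ _)      = no λ ()

  weak∃? : ∀ x ψ → Dec (Weak∃ x ψ)
  weak∃? x ψ = ¬? (any? (dependentUniversal? x) (scope x ψ)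
                   ⊎-dec any? (sharedConjunction? x) (scope x ψ))

  weak∀? : ∀ x ψ → Dec (Weak∀ x ψ)
  weak∀? x ψ = ¬? (any? (dependentExistential? x) (scope x ψ))
               ×-dec ¬? (any? (sharedDisjunction? x) (scope x ψ))

  strong-qr : Formula τ → ℕ
  strong-qr (atom a) = 0
  strong-qr (¬ᶠ φ)   = strong-qr φ
  strong-qr (φ ∧ᶠ ψ) = strong-qr φ ⊔ strong-qr ψ
  strong-qr (φ ∨ᶠ ψ) = strong-qr φ ⊔ strong-qr ψ
  strong-qr (∃ᶠ x φ) = if does (weak∃? x φ) then strong-qr φ else suc (strong-qr φ)
  strong-qr (∀ᶠ x φ) = if does (weak∀? x φ) then strong-qr φ else suc (strong-qr φ)

  strong-bound : Formula τ → List Var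
  strong-bound (atom a) = []
  strong-bound (¬ᶠ φ)   = strong-bound φ
  strong-bound (φ ∧ᶠ ψ) = strong-bound φ ++ strong-bound ψ
  strong-bound (φ ∨ᶠ ψ) = strong-bound φ ++ strong-bound ψ
  strong-bound (∃ᶠ x φ) = if does (weak∃? x φ) then strong-bound φ else x ∷ strong-bound φ
  strong-bound (∀ᶠ x φ) = if does (weak∀? x φ) then strong-bound φ else x ∷ strong-bound φ

{-# OPTIONS --safe #-}

-- All weak existential quantifiers of a block (the part of φ outside every universal quantifier) are
-- replaced at once by colour coding. A witness of the weak quantifier number j is only known to lie in a
-- class C j; classes of different witnesses, and of witnesses and other relevant elements, are disjoint
-- wherever φ demands an inequality. A weakly bound variable occurs in at most one other literal
-- of a choice of disjuncts, so its witness can then be sought anew at this literal, which costs at most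
-- arity τ quantifiers at the leaves. The classes are residue classes modulo a number p that separates the
-- finitely many relevant elements, with the residues coded by Gödel's β-function: p and all the coding
-- moduli have the form 1 + i b with i constant, so two parameters a and b describe all classes.
-- Universal subformulas that depend on no strong quantifier of the block are moved in front of the
-- parameters; every other path out of a block passes a strong quantifier, which accounts for the factor
-- 3 = 1 + 2. Universal blocks are treated by duality, and structures that are too small for the
-- number theory by replacing elements by numerals.

module Submission where

open import Data.Bool using (true; false; if_then_else_; T?)
open import Data.Fin using (toℕ; fromℕ<; zero; suc)
import Data.Fin.Properties as Fin
open import Data.List using (List; []; _∷_; [_]; _++_; length; filter; upTo; foldr; cartesianProductWith; deduplicate; removeAt) renaming (map to mapˡ)
open import Data.List.Extrema.Nat using (max; ⊥≤max; xs≤max)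
open import Data.List.Membership.Propositional using (_∈_; _∉_; find; lose)
open import Data.List.Membership.Propositional.Properties using (∈-filter⁺; ∈-filter⁻; ∈-++⁺ˡ; ∈-++⁺ʳ; ∈-++⁻; ∈-upTo⁺; ∈-upTo⁻; ∈-map⁺; ∈-map⁻; ∈-cartesianProductWith⁺; ∈-deduplicate⁺; ∈-deduplicate⁻; ∈-lookup)
open import Data.List.Properties using (map-++; length-++; length-map; length-upTo; length-removeAt′)
open import Data.List.Relation.Unary.All as All using (All; []; _∷_)
import Data.List.Relation.Unary.All.Properties as All
open import Data.List.Relation.Unary.AllPairs using ([]; _∷_)
open import Data.List.Relation.Unary.Any as Any using (Any; here; there)
import Data.List.Relation.Unary.Any.Properties as Any
open import Data.List.Relation.Unary.Unique.Propositional using (Unique)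
import Data.List.Relation.Unary.Unique.Propositional.Properties as Unique
open import Data.Maybe using (Maybe; just; nothing; maybe′)
open import Data.Nat using (ℕ; zero; suc; _≤_; _<_; _≟_; _≤?_; _<?_; _⊔_; _⊓_; _+_; _*_; _∸_; _^_; _!; ∣_-_∣; s≤s; z≤n; s≤s⁻¹; NonZero; >-nonZero; ≢-nonZero)
open import Data.Nat.Coprimality as Coprimality using (Coprime; coprime-divisor; coprime-Bézout; 1-coprimeTo)
open import Data.Nat.DivMod using (_%_; _/_; %-remove-+ˡ; %-distribˡ-+; %-distribˡ-*; m%n%n≡m%n; m≡m%n+[m/n]*n; [m+kn]%n≡m%n; m<n⇒m%n≡m; m%n<n; m%n≤m; m/n*n≤m; m/n≤m)
open import Data.Nat.Divisibility
open import Data.Nat.GCD using (module Bézout)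
open import Data.Nat.Properties
open import Data.Nat.Tactic.RingSolver using (solve-∀)
open import Data.List.Membership.DecPropositional _≟_ using (_∈?_)
open import Data.List.Relation.Unary.Unique.DecPropositional.Properties _≟_ using (deduplicate-!)
open import Data.Product as Product using (∃-syntax; _×_; _,_; proj₁; proj₂)
open import Data.Sum as Sum using (_⊎_; inj₁; inj₂; [_,_]′)
open import Data.Unit using (⊤; tt)
import Data.Unit.Polymorphic as Polymorphic
open import Data.Vec as Vec using (Vec; []; _∷_)
open import Function using (_∘_; id)
open import Function.Bundles using (_⇔_; mk⇔; Equivalence; Inverse)
open import Level using (0ℓ)
open import Relation.Binary.Definitions using (tri<; tri≈; tri>)
open import Relation.Binary.PropositionalEquality using (_≡_; _≢_; refl; sym; trans; cong; cong₂; subst; subst₂; module ≡-Reasoning)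
open import Relation.Nullary using (¬_; Dec; yes; no; does; contradiction; ¬?)
open import Relation.Nullary.Decidable using (dec-true; dec-false; map′; _×-dec_; _⊎-dec_; decidable-stable; does-⇔; toWitness)
open import Relation.Unary using (Pred; Decidable)
open import Relation.Unary.Properties using (∁?)
open import Defs

open Equivalence using (to; from)


-- Number theory

-- The obstacle to soundness is that witnesses are sought separately at each literal, yet one
-- assignment must serve all literals. The induction therefore yields assignments that stay
-- satisfying when the values at inessential variables move within their classes (`Robust`), and two
-- such assignments can be glued at a conjunction. This works for arbitrary nonempty classes, so
-- quantifying over all parameters does no harm, and arithmetic enters only for completeness. There
-- two demands conflict. The code `a` is bounded by the product of its moduli and must be an
-- element, which asks for small moduli; but only large moduli ensure that few of them divide a
-- difference of elements. Taking `b` of the order of the `K + 1`-st root of the size of the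
-- structure meets both. The numbers of colours and of inequalities are bounded by `size φ`, so all
-- thresholds depend on `φ` alone, and the index of the separating modulus ranges over constants: it
-- costs a disjunction and no quantifier.

coprime-* : ∀ {m x y} → Coprime m x → Coprime m y → Coprime m (x * y)
coprime-* cx cy (d∣m , d∣xy) =
  cy (d∣m , coprime-divisor (λ (e∣d , e∣x) → cx (∣-trans e∣d d∣m , e∣x)) d∣xy)

coprime-∣-* : ∀ {m n d} → Coprime m n → m ∣ d → n ∣ d → m * n ∣ d
coprime-∣-* {m} {n} c (divides q refl) n∣d =
  subst (m * n ∣_) (*-comm m q) (*-monoʳ-∣ m (coprime-divisor (Coprimality.sym c) (subst (n ∣_) (*-comm q m) n∣d)))

-- The moduli of Gödel's β-function; the shift `suc i` keeps index 0 from giving the modulus 1 when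
-- `b` is positive.
modulus : ℕ → ℕ → ℕ
modulus b i = suc (suc i * b)

coprime-linear : ∀ {d b c} → d ∣ suc (c * b) → Coprime d b
coprime-linear {b = b} {c} d∣ {e} (e∣d , e∣b) =
  ∣1⇒≡1 (∣m+n∣m⇒∣n (subst (e ∣_) (+-comm 1 (c * b)) (∣-trans e∣d d∣)) (∣n⇒∣m*n c e∣b))

-- A common divisor divides the difference `(j - i) * b` and is coprime to `b`, so it divides
-- `j - i`, which is less than `J`. Hence it divides `J !` and with it `b`, and must be 1.
modulus-coprime< : ∀ {b J} i j → J ! ∣ b → i < j → j < J → Coprime (modulus b i) (modulus b j)
modulus-coprime< {b} {J} i j J!∣b i<j j<J {d} (d∣mᵢ , d∣mⱼ) = coprime-linear {c = suc i} d∣mᵢ (∣-refl , d∣b)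
  where
  k = j ∸ suc i
  j≡ : suc j ≡ suc k + suc i
  j≡ = sym (trans (cong suc (trans (+-suc k i) (sym (+-suc k i)))) (cong suc (m∸n+n≡m i<j)))
  split : modulus b j ≡ modulus b i + suc k * b
  split = trans (cong (λ z → suc (z * b)) j≡) (eq k i b)
    where
    eq : ∀ k i b → suc ((suc k + suc i) * b) ≡ suc (suc i * b) + suc k * b
    eq = solve-∀
  d∣kb : d ∣ suc k * b
  d∣kb = ∣m+n∣m⇒∣n (subst (d ∣_) split d∣mⱼ) d∣mᵢ
  d∣k : d ∣ suc k
  d∣k = coprime-divisor (coprime-linear {c = suc i} d∣mᵢ) (subst (d ∣_) (*-comm (suc k) b) d∣kb)
  k<J : suc k ≤ J
  k<J = ≤-trans (s≤s (m∸n≤m j (suc i))) j<J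
  d∣b : d ∣ b
  d∣b = ∣-trans d∣k (∣-trans (∣-trans (m∣m*n (k !)) (m≤n⇒m!∣n! k<J)) J!∣b)

modulus-coprime : ∀ {b J} i j → J ! ∣ b → i ≢ j → i < J → j < J → Coprime (modulus b i) (modulus b j)
modulus-coprime i j J!∣b i≢j i<J j<J with <-cmp i j
... | tri< i<j _ _ = modulus-coprime< i j J!∣b i<j j<J
... | tri≈ _ i≡j _ = contradiction i≡j i≢j
... | tri> _ _ j<i = Coprimality.sym (modulus-coprime< j i J!∣b j<i i<J)

∏[_] : ℕ → (ℕ → ℕ) → ℕ
∏[ zero ]  m = 1
∏[ suc k ] m = ∏[ k ] m * m k

∏-coprime : ∀ k {m x} → (∀ j → j < k → Coprime x (m j)) → Coprime x (∏[ k ] m)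
∏-coprime zero    c = Coprimality.sym (1-coprimeTo _)
∏-coprime (suc k) c = coprime-* (∏-coprime k λ j j<k → c j (m<n⇒m<1+n j<k)) (c k ≤-refl)

∏-∣ : ∀ k m {j} → j < k → m j ∣ ∏[ k ] m
∏-∣ (suc k) m {j} j<1+k with m≤n⇒m<n∨m≡n (s≤s⁻¹ j<1+k)
... | inj₁ j<k  = ∣m⇒∣m*n (m k) (∏-∣ k m j<k)
... | inj₂ refl = n∣m*n (∏[ k ] m)

∏-≤-^ : ∀ k m {c} → (∀ j → j < k → m j ≤ c) → ∏[ k ] m ≤ c ^ k
∏-≤-^ zero    m m≤c = ≤-refl
∏-≤-^ (suc k) m {c} m≤c = subst (∏[ k ] m * m k ≤_) (*-comm (c ^ k) c)
  (*-mono-≤ (∏-≤-^ k m λ j j<k → m≤c j (m<n⇒m<1+n j<k)) (m≤c k ≤-refl))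

-- Up to sign, the Bézout coefficient `x` is an inverse of `P` modulo `suc n`. To avoid subtraction,
-- `n * a` and `n * r` stand for the negatives of `a` and `r`.
solve-congruence : ∀ {P n} a r → Coprime P (suc n) → r < suc n → ∃[ t ] (t * P + a) % suc n ≡ r
solve-congruence {P} {n} a r c r<n with coprime-Bézout c
... | Bézout.+- x y eq = x * (r + n * a) , (begin
  (x * (r + n * a) * P + a) % suc n              ≡⟨ cong (_% suc n) lemma ⟩
  (r + (a + y * (r + n * a)) * suc n) % suc n    ≡⟨ [m+kn]%n≡m%n r (a + y * (r + n * a)) (suc n) ⟩
  r % suc n                                      ≡⟨ m<n⇒m%n≡m r<n ⟩
  r                                              ∎)
  where
  open ≡-Reasoning
  e₁ : ∀ x r n a P → x * (r + n * a) * P + a ≡ (r + n * a) * (x * P) + a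
  e₁ = solve-∀
  e₂ : ∀ y r n a → (r + n * a) * (1 + y * suc n) + a ≡ r + (a + y * (r + n * a)) * suc n
  e₂ = solve-∀
  lemma : x * (r + n * a) * P + a ≡ r + (a + y * (r + n * a)) * suc n
  lemma = trans (e₁ x r n a P) (trans (cong (λ z → (r + n * a) * z + a) (sym eq)) (e₂ y r n a))
... | Bézout.-+ x y eq = x * (a + n * r) , (begin
  (x * (a + n * r) * P + a) % suc n              ≡⟨ [m+kn]%n≡m%n (x * (a + n * r) * P + a) r (suc n) ⟨
  (x * (a + n * r) * P + a + r * suc n) % suc n  ≡⟨ cong (_% suc n) lemma ⟩
  (r + y * (a + n * r) * suc n) % suc n          ≡⟨ [m+kn]%n≡m%n r (y * (a + n * r)) (suc n) ⟩
  r % suc n                                      ≡⟨ m<n⇒m%n≡m r<n ⟩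
  r                                              ∎)
  where
  open ≡-Reasoning
  e₁ : ∀ x r n a P → x * (a + n * r) * P + a + r * suc n ≡ r + (a + n * r) * (1 + x * P)
  e₁ = solve-∀
  e₂ : ∀ y r n a → r + (a + n * r) * (y * suc n) ≡ r + y * (a + n * r) * suc n
  e₂ = solve-∀
  lemma : x * (a + n * r) * P + a + r * suc n ≡ r + y * (a + n * r) * suc n
  lemma = trans (e₁ x r n a P) (trans (cong (λ z → r + (a + n * r) * z) eq) (e₂ y r n a))

chinese-remainder : ∀ k (m r : ℕ → ℕ) →
  (∀ i j → i < k → j < k → i ≢ j → Coprime (suc (m i)) (suc (m j))) →
  (∀ j → j < k → r j < suc (m j)) →
  ∃[ a ] a < ∏[ k ] (suc ∘ m) × (∀ j → j < k → a % suc (m j) ≡ r j)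
chinese-remainder zero    m r c r< = 0 , s≤s z≤n , λ _ ()
chinese-remainder (suc k) m r c r<
  with a , a<P , a≡ ← chinese-remainder k m r
         (λ i j i<k j<k → c i j (m<n⇒m<1+n i<k) (m<n⇒m<1+n j<k)) (λ j j<k → r< j (m<n⇒m<1+n j<k))
  with t , t≡ ← solve-congruence a (r k)
         (Coprimality.sym (∏-coprime k {suc ∘ m} (λ j j<k → c k j ≤-refl (m<n⇒m<1+n j<k) (<⇒≢ j<k ∘ sym)))) (r< k ≤-refl)
  = t′ * P + a , small , residue
  where
  open ≡-Reasoning
  n = m k
  P = ∏[ k ] (suc ∘ m)
  -- Reducing `t` keeps the solution below the product of all moduli; this bound later places the
  -- code inside the structure.
  t′ = t % suc n
  small : t′ * P + a < P * suc n
  small = subst (t′ * P + a <_) (*-comm (suc n) P) (<-≤-trans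
    (subst (t′ * P + a <_) (+-comm (t′ * P) P) (+-monoʳ-< (t′ * P) a<P))
    (*-monoˡ-≤ P (m%n<n t (suc n))))
  residue : ∀ j → j < suc k → (t′ * P + a) % suc (m j) ≡ r j
  residue j j<1+k with m≤n⇒m<n∨m≡n (s≤s⁻¹ j<1+k)
  ... | inj₁ j<k = trans (%-remove-+ˡ a {suc (m j)} (∣n⇒∣m*n t′ (∏-∣ k (suc ∘ m) j<k))) (a≡ j j<k)
  ... | inj₂ refl = begin
    (t′ * P + a) % suc n                       ≡⟨ %-distribˡ-+ (t′ * P) a (suc n) ⟩
    ((t′ * P) % suc n + a % suc n) % suc n     ≡⟨ cong (λ z → (z + a % suc n) % suc n) reduce ⟩
    ((t * P) % suc n + a % suc n) % suc n      ≡⟨ %-distribˡ-+ (t * P) a (suc n) ⟨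
    (t * P + a) % suc n                        ≡⟨ t≡ ⟩
    r k                                        ∎
    where
    reduce : (t′ * P) % suc n ≡ (t * P) % suc n
    reduce = begin
      (t′ * P) % suc n                         ≡⟨ %-distribˡ-* t′ P (suc n) ⟩
      (t′ % suc n * (P % suc n)) % suc n       ≡⟨ cong (λ z → (z * (P % suc n)) % suc n) (m%n%n≡m%n t (suc n)) ⟩
      (t′ * (P % suc n)) % suc n               ≡⟨ %-distribˡ-* t P (suc n) ⟨
      (t * P) % suc n                          ∎

-- Residue classes that separate finitely many numbers, and their codes

%-≡⇒∣∣-∣ : ∀ u v {m} .{{_ : NonZero m}} → u % m ≡ v % m → m ∣ ∣ u - v ∣
%-≡⇒∣∣-∣ u v {m} eq = divides ∣ u / m - v / m ∣ (begin
  ∣ u - v ∣                                  ≡⟨ cong₂ ∣_-_∣ (m≡m%n+[m/n]*n u m) (trans (m≡m%n+[m/n]*n v m) (cong (_+ v / m * m) (sym eq))) ⟩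
  ∣ u % m + u / m * m - u % m + v / m * m ∣  ≡⟨ ∣m+n-m+o∣≡∣n-o∣ (u % m) (u / m * m) (v / m * m) ⟩
  ∣ u / m * m - v / m * m ∣                  ≡⟨ *-distribʳ-∣-∣ m (u / m) (v / m) ⟨
  ∣ u / m - v / m ∣ * m                      ∎)
  where open ≡-Reasoning

length-filter-∁ : ∀ {P : Pred ℕ 0ℓ} (P? : Decidable P) is →
                  length is ≡ length (filter P? is) + length (filter (∁? P?) is)
length-filter-∁ P? []       = refl
length-filter-∁ P? (i ∷ is) with P? i
... | yes _ = cong suc (length-filter-∁ P? is)
... | no  _ = trans (cong suc (length-filter-∁ P? is)) (sym (+-suc _ _))

Separated : (ℕ → ℕ) → List (ℕ × ℕ) → Set
Separated f D = All (λ p → f (proj₁ p) ≢ f (proj₂ p)) D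

module _ (b J : ℕ) (J!∣b : J ! ∣ b) where

  -- The moduli are pairwise coprime, so their product divides `d`; each is larger than `b`, which
  -- gives `b ^ length is ≤ d < b ^ L`.
  divisors-few : ∀ {d L} → d ≢ 0 → d < b ^ L → ∀ is → Unique is → All (_< J) is →
                 All (λ i → modulus b i ∣ d) is → length is < L
  divisors-few {d} {L} d≢0 d<b^L is u <J ∣d = ≰⇒> λ L≤ →
    <⇒≱ d<b^L (≤-trans (^-monoʳ-≤ b {{b≢0}} L≤) (≤-trans (^≤∏ is) (∣⇒≤ {{≢-nonZero d≢0}} (∏∣d is u <J ∣d))))
    where
    b≢0 : NonZero b
    b≢0 = ≢-nonZero (λ { refl → go0 L d<b^L })
      where
      go0 : ∀ L → ¬ d < 0 ^ L
      go0 zero    (s≤s z≤n) = d≢0 refl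
    ∏ : List ℕ → ℕ
    ∏ []       = 1
    ∏ (i ∷ is) = modulus b i * ∏ is
    ^≤∏ : ∀ is → b ^ length is ≤ ∏ is
    ^≤∏ []       = ≤-refl
    ^≤∏ (i ∷ is) = *-mono-≤ (m≤n⇒m≤1+n (m≤m+n b (i * b))) (^≤∏ is)
    ∏-cop : ∀ {i} is → All (i ≢_) is → i < J → All (_< J) is → Coprime (modulus b i) (∏ is)
    ∏-cop []       _ _ _ = Coprimality.sym (1-coprimeTo _)
    ∏-cop (j ∷ is) (i≢j ∷ ne) i<J (j<J ∷ <J) =
      coprime-* (modulus-coprime _ j J!∣b i≢j i<J j<J) (∏-cop is ne i<J <J)
    ∏∣d : ∀ is → Unique is → All (_< J) is → All (λ i → modulus b i ∣ d) is → ∏ is ∣ d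
    ∏∣d []       _        _          _          = 1∣ d
    ∏∣d (i ∷ is) (ne ∷ u) (i<J ∷ <J) (i∣ ∷ ∣d) =
      coprime-∣-* (∏-cop is ne i<J <J) i∣ (∏∣d is u <J ∣d)

  -- Each pair spoils fewer than `L` indices, those whose modulus divides the difference, and they
  -- are removed one pair after another. The strict inequality leaves an index over at the end.
  separating-index : ∀ {L} D → All (λ (u , v) → u < b ^ L × v < b ^ L × u ≢ v) D →
    ∀ is → Unique is → All (_< J) is → length D * L < length is →
    ∃[ i ] i ∈ is × Separated (_% modulus b i) D
  separating-index         []            []                     (i ∷ is) _    _  _   = i , here refl , []
  separating-index {L} ((u , v) ∷ D) ((u< , v< , u≢v) ∷ ds) is       uniq <J big
    = let i , i∈ , sep     = separating-index D ds (filter (∁? bad?) is)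
                               (Unique.filter⁺ (∁? bad?) uniq) (All.filter⁺ (∁? bad?) <J) many
          i∈is , ¬bad = ∈-filter⁻ (∁? bad?) i∈
      in i , i∈is , (λ eq → ¬bad (%-≡⇒∣∣-∣ u v eq)) ∷ sep
    where
    bad? : Decidable (λ i → modulus b i ∣ ∣ u - v ∣)
    bad? i = modulus b i ∣? ∣ u - v ∣
    few : length (filter bad? is) < L
    few = divisors-few (u≢v ∘ ∣m-n∣≡0⇒m≡n)
      (≤-<-trans (∣m-n∣≤m⊔n u v) (⊔-pres-<m u< v<)) _
      (Unique.filter⁺ bad? uniq) (All.filter⁺ bad? <J) (All.all-filter bad? is)
    many : length D * L < length (filter (∁? bad?) is)
    many = +-cancelˡ-< L _ _ (<-≤-trans big (≤-trans (≤-reflexive (length-filter-∁ bad? is))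
             (+-monoˡ-≤ _ (<⇒≤ few))))

-- An upward search from `t₀` for the first value beyond `x`; it stops because `t ≤ f t`.
bracket : ∀ (f : ℕ → ℕ) t₀ x → (∀ t → t ≤ f t) → f t₀ ≤ x → ∃[ t ] t₀ ≤ t × f t ≤ x × x < f (suc t)
bracket f t₀ x id≤f ft₀≤x = go (x ∸ t₀) t₀ ≤-refl (≤-trans (m≤n+m∸n x t₀) (≤-reflexive (+-comm t₀ _))) ft₀≤x
  where
  go : ∀ gap t → t₀ ≤ t → x ≤ gap + t → f t ≤ x → ∃[ t ] t₀ ≤ t × f t ≤ x × x < f (suc t)
  go zero      t t₀≤t x≤ ft≤x = t , t₀≤t , ft≤x , <-≤-trans (s≤s x≤) (id≤f (suc t))
  go (suc gap) t t₀≤t x≤ ft≤x with f (suc t) ≤? x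
  ... | yes le = go gap (suc t) (m≤n⇒m≤1+n t₀≤t) (≤-trans x≤ (≤-reflexive (sym (+-suc gap t)))) le
  ... | no ≰   = t , t₀≤t , ft≤x , ≰⇒> ≰

-- The residues h j % modulus b i are coded by a as in Gödel's β-function.
record Hashing (K M last : ℕ) (h : ℕ → ℕ) (D : List (ℕ × ℕ)) : Set where
  field
    i a b     : ℕ
    i<M       : i < M
    a≤last    : a ≤ last
    b≥1       : 1 ≤ b
    bounded   : ∀ j → j < M + K → modulus b j ≤ last
    residue   : ∀ j → j < K → a % modulus b (M + j) ≡ h j % modulus b i
    separated : Separated (_% modulus b i) D

-- Origin of the constants: there are `K` colours and at most `K` inequalities. Each inequality
-- excludes fewer than `L` indices, so `M` candidates contain a good one; `K` further moduli code
-- the residues, which makes `J` in all. The factor `J !` of `b` makes them coprime, and `c` is such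
-- that each is at most `c * t`. By `lower`, every single modulus and every product of `K` of them
-- is at most `last`; by `upper` and `t≥2c`, `last` is below `b ^ L`.
module _ (K k L M J c t b last : ℕ) (k≡ : k ≡ suc K) (L≡ : L ≡ 2 * k) (M≡ : M ≡ suc (K * L)) (J≡ : J ≡ M + K)
         (c≡ : c ≡ suc (J * J !)) (b≡ : b ≡ J ! * t)
         (t≥2c : 2 * c ≤ t) (lower : (c * t) ^ k ≤ last) (upper : last < (c * suc t) ^ k) where

  private
    c≥1 : 1 ≤ c
    c≥1 = subst (1 ≤_) (sym c≡) (s≤s z≤n)

    t≥1 : 1 ≤ t
    t≥1 = ≤-trans c≥1 (≤-trans (m≤m+n c _) t≥2c)

    J!∣b : J ! ∣ b
    J!∣b = subst (J ! ∣_) (sym b≡) (m∣m*n t)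

    instance
      c*t≢0 : NonZero (c * t)
      c*t≢0 = >-nonZero (*-mono-≤ c≥1 t≥1)

    power≤last : c * t * (c * t) ^ K ≤ last
    power≤last = subst (λ k → (c * t) ^ k ≤ last) k≡ lower

    c*t≤last : c * t ≤ last
    c*t≤last = ≤-trans (m≤m*n (c * t) ((c * t) ^ K) {{m^n≢0 (c * t) K}}) power≤last

    last<b^L : last < b ^ L
    last<b^L = begin-strict
      last                   <⟨ upper ⟩
      (c * suc t) ^ k        ≤⟨ ^-monoˡ-≤ k (*-monoʳ-≤ c (+-monoˡ-≤ t t≥1)) ⟩
      (c * (t + t)) ^ k      ≡⟨ cong (_^ k) (double c t) ⟩
      (2 * c * t) ^ k        ≤⟨ ^-monoˡ-≤ k (*-monoˡ-≤ t t≥2c) ⟩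
      (t * t) ^ k            ≤⟨ ^-monoˡ-≤ k (*-mono-≤ t≤b t≤b) ⟩
      (b * b) ^ k            ≡⟨ cong (λ z → (b * z) ^ k) (*-identityʳ b) ⟨
      (b ^ 2) ^ k            ≡⟨ ^-*-assoc b 2 k ⟩
      b ^ (2 * k)            ≡⟨ cong (b ^_) L≡ ⟨
      b ^ L                  ∎
      where
      open ≤-Reasoning
      double : ∀ c t → c * (t + t) ≡ 2 * c * t
      double = solve-∀
      t≤b : t ≤ b
      t≤b = subst (t ≤_) (sym b≡) (m≤n*m t (J !) {{>-nonZero (1≤n! J)}})

    modulus≤ : ∀ j → j < J → modulus b j ≤ c * t
    modulus≤ j j<J = begin
      1 + suc j * b      ≤⟨ +-mono-≤ t≥1 (*-monoˡ-≤ b j<J) ⟩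
      t + J * b          ≡⟨ cong (λ z → t + J * z) b≡ ⟩
      t + J * (J ! * t)  ≡⟨ cong (t +_) (*-assoc J (J !) t) ⟨
      suc (J * J !) * t  ≡⟨ cong (_* t) c≡ ⟨
      c * t              ∎
      where open ≤-Reasoning

    M+<J : ∀ {j} → j < K → M + j < J
    M+<J {j} j<K = subst (M + j <_) (sym J≡) (+-monoʳ-< M j<K)

    M≤J : M ≤ J
    M≤J = subst (M ≤_) (sym J≡) (m≤m+n M K)

  hashing-between-powers : ∀ h D → length D ≤ K →
    All (λ (u , v) → u ≤ last × v ≤ last × u ≢ v) D → Hashing K M last h D
  hashing-between-powers h D D≤K ds
    = let i , i∈ , sep = separation
          a , a<∏ , a≡ = coded i (∈-upTo⁻ i∈)
      in record
    { i         = i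
    ; a         = a
    ; b         = b
    ; i<M       = ∈-upTo⁻ i∈
    ; a≤last    = begin
        a                                 ≤⟨ <⇒≤ a<∏ ⟩
        ∏[ K ] (λ j → modulus b (M + j))  ≤⟨ ∏-≤-^ K _ (λ j j<K → modulus≤ (M + j) (M+<J j<K)) ⟩
        (c * t) ^ K                       ≤⟨ m≤n*m ((c * t) ^ K) (c * t) ⟩
        c * t * (c * t) ^ K               ≤⟨ power≤last ⟩
        last                              ∎
    ; b≥1       = subst (1 ≤_) (sym b≡) (*-mono-≤ (1≤n! J) t≥1)
    ; bounded   = λ j j<M+K → ≤-trans (modulus≤ j (subst (j <_) (sym J≡) j<M+K)) c*t≤last
    ; residue   = a≡
    ; separated = sep
    }
    where
    open ≤-Reasoning
    separation : ∃[ i ] i ∈ upTo M × Separated (_% modulus b i) D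
    separation = separating-index b J J!∣b {L} D
      (All.map (λ (u≤ , v≤ , u≢v) → ≤-<-trans u≤ last<b^L , ≤-<-trans v≤ last<b^L , u≢v) ds)
      (upTo M) (Unique.upTo⁺ M) (All.tabulate λ i∈ → ≤-trans (∈-upTo⁻ i∈) M≤J)
      (subst (length D * L <_) (sym (trans (length-upTo M) M≡)) (s≤s (*-monoˡ-≤ L D≤K)))
    coded : ∀ i → i < M → ∃[ a ] a < ∏[ K ] (λ j → modulus b (M + j)) ×
                          (∀ j → j < K → a % modulus b (M + j) ≡ h j % modulus b i)
    coded i i<M = chinese-remainder K (λ j → suc (M + j) * b) (λ j → h j % modulus b i)
      (λ j j′ j<K j′<K j≢j′ → modulus-coprime (M + j) (M + j′) J!∣b (j≢j′ ∘ +-cancelˡ-≡ M j j′)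
        (M+<J j<K) (M+<J j′<K))
      -- The coding moduli have indices from `M` on, so each is at least the separating modulus and
      -- has room for its residues.
      (λ j _ → <-≤-trans (m%n<n (h j) (modulus b i)) (s≤s (*-monoˡ-≤ b (s≤s (≤-trans (<⇒≤ i<M) (m≤m+n M j))))))

-- `M` and the threshold depend on `K` only. The threshold is the value at `2 * c` of the function
-- to be bracketed, so that the search can start there and `t≥2c` holds.
hashing : ∀ K → ∃[ M ] ∃[ N ] ∀ last → N ≤ last → ∀ h D → length D ≤ K →
          All (λ (u , v) → u ≤ last × v ≤ last × u ≢ v) D → Hashing K M last h D
hashing K = M , (c * (2 * c)) ^ suc K , λ last N≤last →
  let t , 2c≤t , lower , upper = bracket (λ t → (c * t) ^ suc K) (2 * c) last id≤ N≤last
  in hashing-between-powers K (suc K) (2 * suc K) M (M + K) c t ((M + K) ! * t) last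
       refl refl refl refl refl refl 2c≤t lower upper
  where
  M c : ℕ
  M = suc (K * (2 * suc K))
  c = suc ((M + K) * (M + K) !)
  id≤ : ∀ t → t ≤ (c * t) ^ suc K
  id≤ zero      = z≤n
  id≤ t@(suc _) = ≤-trans (m≤n*m t c) (m≤m*n (c * t) ((c * t) ^ K) {{m^n≢0 (c * t) K}})

-- Syntax and duality

module _ {τ : Signature} where

  ⊥ᶠ ⊤ᶠ : Formula τ
  ⊥ᶠ = ¬ᶠ (atom (const zero ≐ const zero))
  ⊤ᶠ = atom (const zero ≐ const zero)

  ⋁ ⋀ : List (Formula τ) → Formula τ
  ⋁ = foldr _∨ᶠ_ ⊥ᶠ
  ⋀ = foldr _∧ᶠ_ ⊤ᶠ

  numeral : ℕ → Term τ
  numeral zero    = const zero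
  numeral (suc n) = succ (numeral n)

  substᵗ : (Var → Term τ) → Term τ → Term τ
  substᵗ σ (var x)   = σ x
  substᵗ σ (const c) = const c
  substᵗ σ (succ t)  = succ (substᵗ σ t)

  substᵃ : (Var → Term τ) → Atom τ → Atom τ
  substᵃ σ (rel R ts) = rel R (Vec.map (substᵗ σ) ts)
  substᵃ σ (t ≐ u)    = substᵗ σ t ≐ substᵗ σ u

  _[_≔_]ˢ : (Var → Term τ) → Var → Term τ → Var → Term τ
  (σ [ x ≔ t ]ˢ) y = if does (x ≟ y) then t else σ y

  -- Bound names are renamed as well, so an injective `ι` causes no capture.
  rename : (Var → Var) → Formula τ → Formula τ
  rename ι (atom a) = atom (substᵃ (var ∘ ι) a)
  rename ι (¬ᶠ φ)   = ¬ᶠ rename ι φ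
  rename ι (φ ∧ᶠ ψ) = rename ι φ ∧ᶠ rename ι ψ
  rename ι (φ ∨ᶠ ψ) = rename ι φ ∨ᶠ rename ι ψ
  rename ι (∃ᶠ x φ) = ∃ᶠ (ι x) (rename ι φ)
  rename ι (∀ᶠ x φ) = ∀ᶠ (ι x) (rename ι φ)

  qr-rename : ∀ ι φ → qr (rename ι φ) ≡ qr φ
  qr-rename ι (atom a) = refl
  qr-rename ι (¬ᶠ φ)   = qr-rename ι φ
  qr-rename ι (φ ∧ᶠ ψ) = cong₂ _⊔_ (qr-rename ι φ) (qr-rename ι ψ)
  qr-rename ι (φ ∨ᶠ ψ) = cong₂ _⊔_ (qr-rename ι φ) (qr-rename ι ψ)
  qr-rename ι (∃ᶠ x φ) = cong suc (qr-rename ι φ)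
  qr-rename ι (∀ᶠ x φ) = cong suc (qr-rename ι φ)

  bound-rename : ∀ ι φ → bound (rename ι φ) ≡ mapˡ ι (bound φ)
  bound-rename ι (atom a) = refl
  bound-rename ι (¬ᶠ φ)   = bound-rename ι φ
  bound-rename ι (φ ∧ᶠ ψ) = trans (cong₂ _++_ (bound-rename ι φ) (bound-rename ι ψ)) (sym (map-++ ι (bound φ) (bound ψ)))
  bound-rename ι (φ ∨ᶠ ψ) = trans (cong₂ _++_ (bound-rename ι φ) (bound-rename ι ψ)) (sym (map-++ ι (bound φ) (bound ψ)))
  bound-rename ι (∃ᶠ x φ) = cong (ι x ∷_) (bound-rename ι φ)
  bound-rename ι (∀ᶠ x φ) = cong (ι x ∷_) (bound-rename ι φ)

  -- In a structure with at most suc N elements, the first suc N numerals denote all elements.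
  instantiate : ℕ → (Var → Term τ) → Formula τ → Formula τ
  instantiate N σ (atom a) = atom (substᵃ σ a)
  instantiate N σ (¬ᶠ φ)   = ¬ᶠ instantiate N σ φ
  instantiate N σ (φ ∧ᶠ ψ) = instantiate N σ φ ∧ᶠ instantiate N σ ψ
  instantiate N σ (φ ∨ᶠ ψ) = instantiate N σ φ ∨ᶠ instantiate N σ ψ
  instantiate N σ (∃ᶠ x φ) = ⋁ (mapˡ (λ i → instantiate N (σ [ x ≔ numeral i ]ˢ) φ) (upTo (suc N)))
  instantiate N σ (∀ᶠ x φ) = ⋀ (mapˡ (λ i → instantiate N (σ [ x ≔ numeral i ]ˢ) φ) (upTo (suc N)))

  QuantifierFree : Formula τ → Set
  QuantifierFree φ = qr φ ≡ 0 × bound φ ≡ []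

  private
    qf₂ : ∀ {m n} {xs ys : List Var} → m ≡ 0 × xs ≡ [] → n ≡ 0 × ys ≡ [] → m ⊔ n ≡ 0 × xs ++ ys ≡ []
    qf₂ (refl , refl) (refl , refl) = refl , refl

  ⋁-quantifierFree : ∀ {X : Set} (f : X → Formula τ) xs → (∀ x → QuantifierFree (f x)) → QuantifierFree (⋁ (mapˡ f xs))
  ⋁-quantifierFree f []       h = refl , refl
  ⋁-quantifierFree f (x ∷ xs) h = qf₂ (h x) (⋁-quantifierFree f xs h)

  ⋀-quantifierFree : ∀ {X : Set} (f : X → Formula τ) xs → (∀ x → QuantifierFree (f x)) → QuantifierFree (⋀ (mapˡ f xs))
  ⋀-quantifierFree f []       h = refl , refl
  ⋀-quantifierFree f (x ∷ xs) h = qf₂ (h x) (⋀-quantifierFree f xs h)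

  instantiate-quantifierFree : ∀ N σ φ → QuantifierFree (instantiate N σ φ)
  instantiate-quantifierFree N σ (atom a) = refl , refl
  instantiate-quantifierFree N σ (¬ᶠ φ)   = instantiate-quantifierFree N σ φ
  instantiate-quantifierFree N σ (φ ∧ᶠ ψ) = qf₂ (instantiate-quantifierFree N σ φ) (instantiate-quantifierFree N σ ψ)
  instantiate-quantifierFree N σ (φ ∨ᶠ ψ) = qf₂ (instantiate-quantifierFree N σ φ) (instantiate-quantifierFree N σ ψ)
  instantiate-quantifierFree N σ (∃ᶠ x φ) =
    ⋁-quantifierFree _ (upTo (suc N)) λ i → instantiate-quantifierFree N (σ [ x ≔ numeral i ]ˢ) φ
  instantiate-quantifierFree N σ (∀ᶠ x φ) =
    ⋀-quantifierFree _ (upTo (suc N)) λ i → instantiate-quantifierFree N (σ [ x ≔ numeral i ]ˢ) φ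

  vars : Formula τ → List Var
  vars (atom a) = atomVars a
  vars (¬ᶠ φ)   = vars φ
  vars (φ ∧ᶠ ψ) = vars φ ++ vars ψ
  vars (φ ∨ᶠ ψ) = vars φ ++ vars ψ
  vars (∃ᶠ x φ) = x ∷ vars φ
  vars (∀ᶠ x φ) = x ∷ vars φ

  free⊆vars : ∀ φ {x} → x ∈ free φ → x ∈ vars φ
  free⊆vars (atom a) x∈ = x∈
  free⊆vars (¬ᶠ φ)   x∈ = free⊆vars φ x∈
  free⊆vars (φ ∧ᶠ ψ) x∈ with ∈-++⁻ (free φ) x∈
  ... | inj₁ x∈φ = ∈-++⁺ˡ (free⊆vars φ x∈φ)
  ... | inj₂ x∈ψ = ∈-++⁺ʳ (vars φ) (free⊆vars ψ x∈ψ)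
  free⊆vars (φ ∨ᶠ ψ) x∈ with ∈-++⁻ (free φ) x∈
  ... | inj₁ x∈φ = ∈-++⁺ˡ (free⊆vars φ x∈φ)
  ... | inj₂ x∈ψ = ∈-++⁺ʳ (vars φ) (free⊆vars ψ x∈ψ)
  free⊆vars (∃ᶠ y φ) x∈ = there (free⊆vars φ (proj₁ (∈-filter⁻ (λ z → ¬? (z ≟ y)) x∈)))
  free⊆vars (∀ᶠ y φ) x∈ = there (free⊆vars φ (proj₁ (∈-filter⁻ (λ z → ¬? (z ≟ y)) x∈)))

  dual : Formula τ → Formula τ
  dual (atom a) = ¬ᶠ atom a
  dual (¬ᶠ φ)   = φ
  dual (φ ∧ᶠ ψ) = dual φ ∨ᶠ dual ψ
  dual (φ ∨ᶠ ψ) = dual φ ∧ᶠ dual ψ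
  dual (∃ᶠ x φ) = ∀ᶠ x (dual φ)
  dual (∀ᶠ x φ) = ∃ᶠ x (dual φ)

  NNF-dual : ∀ {φ} → NNF φ → NNF (dual φ)
  NNF-dual (pos a)  = neg a
  NNF-dual (neg a)  = pos a
  NNF-dual (p ∧ᶠ q) = NNF-dual p ∨ᶠ NNF-dual q
  NNF-dual (p ∨ᶠ q) = NNF-dual p ∧ᶠ NNF-dual q
  NNF-dual (∃ᶠ x p) = ∀ᶠ x (NNF-dual p)
  NNF-dual (∀ᶠ x p) = ∃ᶠ x (NNF-dual p)

  dual-involutive : ∀ {φ} → NNF φ → dual (dual φ) ≡ φ
  dual-involutive (pos a)  = refl
  dual-involutive (neg a)  = refl
  dual-involutive (p ∧ᶠ q) = cong₂ _∧ᶠ_ (dual-involutive p) (dual-involutive q)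
  dual-involutive (p ∨ᶠ q) = cong₂ _∨ᶠ_ (dual-involutive p) (dual-involutive q)
  dual-involutive (∃ᶠ x p) = cong (∃ᶠ x) (dual-involutive p)
  dual-involutive (∀ᶠ x p) = cong (∀ᶠ x) (dual-involutive p)

  free-dual : ∀ φ → free (dual φ) ≡ free φ
  free-dual (atom a) = refl
  free-dual (¬ᶠ φ)   = refl
  free-dual (φ ∧ᶠ ψ) = cong₂ _++_ (free-dual φ) (free-dual ψ)
  free-dual (φ ∨ᶠ ψ) = cong₂ _++_ (free-dual φ) (free-dual ψ)
  free-dual (∃ᶠ x φ) = cong (filter _) (free-dual φ)
  free-dual (∀ᶠ x φ) = cong (filter _) (free-dual φ)

  vars-dual : ∀ φ → vars (dual φ) ≡ vars φ
  vars-dual (atom a) = refl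
  vars-dual (¬ᶠ φ)   = refl
  vars-dual (φ ∧ᶠ ψ) = cong₂ _++_ (vars-dual φ) (vars-dual ψ)
  vars-dual (φ ∨ᶠ ψ) = cong₂ _++_ (vars-dual φ) (vars-dual ψ)
  vars-dual (∃ᶠ x φ) = cong (x ∷_) (vars-dual φ)
  vars-dual (∀ᶠ x φ) = cong (x ∷_) (vars-dual φ)

  -- `scope` takes a negation as a leaf, whereas `dual` exposes what is below it. On literals the
  -- two are compatible, and `NNF` admits no other negations.
  scope-dual : ∀ x {φ} → NNF φ → scope x (dual φ) ≡ mapˡ dual (scope x φ)
  scope-dual x (pos a)  = refl
  scope-dual x (neg a)  = refl
  scope-dual x {φ ∧ᶠ ψ} (p ∧ᶠ q) = cong (_ ∷_) (trans (cong₂ _++_ (scope-dual x p) (scope-dual x q)) (sym (map-++ dual (scope x φ) (scope x ψ))))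
  scope-dual x {φ ∨ᶠ ψ} (p ∨ᶠ q) = cong (_ ∷_) (trans (cong₂ _++_ (scope-dual x p) (scope-dual x q)) (sym (map-++ dual (scope x φ) (scope x ψ))))
  scope-dual x (∃ᶠ y p) with does (x ≟ y)
  ... | true  = refl
  ... | false = cong (_ ∷_) (scope-dual x p)
  scope-dual x (∀ᶠ y p) with does (x ≟ y)
  ... | true  = refl
  ... | false = cong (_ ∷_) (scope-dual x p)

  scope-NNF : ∀ x {φ : Formula τ} → NNF φ → All NNF (scope x φ)
  scope-NNF x (pos a)  = pos a ∷ []
  scope-NNF x (neg a)  = neg a ∷ []
  scope-NNF x (p ∧ᶠ q) = (p ∧ᶠ q) ∷ All.++⁺ (scope-NNF x p) (scope-NNF x q)
  scope-NNF x (p ∨ᶠ q) = (p ∨ᶠ q) ∷ All.++⁺ (scope-NNF x p) (scope-NNF x q)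
  scope-NNF x (∃ᶠ y p) with does (x ≟ y)
  ... | true  = ∃ᶠ y p ∷ []
  ... | false = ∃ᶠ y p ∷ scope-NNF x p
  scope-NNF x (∀ᶠ y p) with does (x ≟ y)
  ... | true  = ∀ᶠ y p ∷ []
  ... | false = ∀ᶠ y p ∷ scope-NNF x p

  Any-scope-dual : ∀ {P Q : Formula τ → Set} x {φ} → NNF φ →
                   (∀ {χ} → NNF χ → P (dual χ) ⇔ Q χ) →
                   Any P (scope x (dual φ)) ⇔ Any Q (scope x φ)
  Any-scope-dual {P} {Q} x {φ} p h = mk⇔
    (λ any → pull (scope-NNF x p) (Any.map⁻ (subst (Any P) (scope-dual x p) any)))
    (λ any → subst (Any P) (sym (scope-dual x p)) (Any.map⁺ (push (scope-NNF x p) any)))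
    where
    pull : ∀ {χs} → All NNF χs → Any (P ∘ dual) χs → Any Q χs
    pull (q ∷ _)  (here px)   = here (to (h q) px)
    pull (_ ∷ qs) (there any) = there (pull qs any)
    push : ∀ {χs} → All NNF χs → Any Q χs → Any (P ∘ dual) χs
    push (q ∷ _)  (here px)   = here (from (h q) px)
    push (_ ∷ qs) (there any) = there (push qs any)

  essential-dual : ∀ x {χ} → NNF χ → ∃-Essential x (dual χ) ⇔ ∀-Essential x χ
  essential-dual x (pos a)  = mk⇔ id id
  essential-dual x (neg a)  = mk⇔ id id
  essential-dual x (_ ∧ᶠ _) = mk⇔ id id
  essential-dual x (_ ∨ᶠ _) = mk⇔ id id
  essential-dual x (∃ᶠ _ _) = mk⇔ id id
  essential-dual x (∀ᶠ _ _) = mk⇔ id id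

  dependent-dual : ∀ x {χ} → NNF χ → DependentUniversal x (dual χ) ⇔ DependentExistential x χ
  dependent-dual x (pos a)  = mk⇔ id id
  dependent-dual x (neg a)  = mk⇔ id id
  dependent-dual x (_ ∧ᶠ _) = mk⇔ id id
  dependent-dual x (_ ∨ᶠ _) = mk⇔ id id
  dependent-dual x {∃ᶠ y φ} (∃ᶠ _ _) = mk⇔ (subst (x ∈_) (free-dual (∃ᶠ y φ))) (subst (x ∈_) (sym (free-dual (∃ᶠ y φ))))
  dependent-dual x (∀ᶠ _ _) = mk⇔ id id

  shared-dual : ∀ x {χ} → NNF χ → SharedConjunction x (dual χ) ⇔ SharedDisjunction x χ
  shared-dual x (pos a)  = mk⇔ id id
  shared-dual x (neg a)  = mk⇔ id id
  shared-dual x (_ ∧ᶠ _) = mk⇔ id id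
  shared-dual x (p ∨ᶠ q) = mk⇔
    (Product.map (to (Any-scope-dual x p (essential-dual x))) (to (Any-scope-dual x q (essential-dual x))))
    (Product.map (from (Any-scope-dual x p (essential-dual x))) (from (Any-scope-dual x q (essential-dual x))))
  shared-dual x (∃ᶠ _ _) = mk⇔ id id
  shared-dual x (∀ᶠ _ _) = mk⇔ id id

  Weak-dual : ∀ x {φ} → NNF φ → Weak∃ x (dual φ) ⇔ Weak∀ x φ
  Weak-dual x p = mk⇔
    (λ w → (λ any → w (inj₁ (from D any))) , (λ any → w (inj₂ (from S any))))
    (λ (¬d , ¬s) → [ (λ any → ¬d (to D any)) , (λ any → ¬s (to S any)) ]′)
    where
    D = Any-scope-dual x p (dependent-dual x)
    S = Any-scope-dual x p (shared-dual x)

  weak∃?-dual : ∀ x {φ} → NNF φ → does (weak∃? x (dual φ)) ≡ does (weak∀? x φ)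
  weak∃?-dual x {φ} p = does-⇔ (Weak-dual x p) (weak∃? x (dual φ)) (weak∀? x φ)

  weak∀?-dual : ∀ x {φ} → NNF φ → does (weak∀? x (dual φ)) ≡ does (weak∃? x φ)
  weak∀?-dual x {φ} p = trans (sym (weak∃?-dual x (NNF-dual p))) (cong (λ ψ → does (weak∃? x ψ)) (dual-involutive p))

  strong-qr-dual : ∀ {φ} → NNF φ → strong-qr (dual φ) ≡ strong-qr φ
  strong-qr-dual (pos a)  = refl
  strong-qr-dual (neg a)  = refl
  strong-qr-dual (p ∧ᶠ q) = cong₂ _⊔_ (strong-qr-dual p) (strong-qr-dual q)
  strong-qr-dual (p ∨ᶠ q) = cong₂ _⊔_ (strong-qr-dual p) (strong-qr-dual q)
  strong-qr-dual (∃ᶠ x p) = cong₂ (λ b n → if b then n else suc n) (weak∀?-dual x p) (strong-qr-dual p)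
  strong-qr-dual (∀ᶠ x p) = cong₂ (λ b n → if b then n else suc n) (weak∃?-dual x p) (strong-qr-dual p)

  strong-bound-dual : ∀ {φ} → NNF φ → strong-bound (dual φ) ≡ strong-bound φ
  strong-bound-dual (pos a)  = refl
  strong-bound-dual (neg a)  = refl
  strong-bound-dual (p ∧ᶠ q) = cong₂ _++_ (strong-bound-dual p) (strong-bound-dual q)
  strong-bound-dual (p ∨ᶠ q) = cong₂ _++_ (strong-bound-dual p) (strong-bound-dual q)
  strong-bound-dual (∃ᶠ x p) = cong₂ (λ b xs → if b then xs else x ∷ xs) (weak∀?-dual x p) (strong-bound-dual p)
  strong-bound-dual (∀ᶠ x p) = cong₂ (λ b xs → if b then xs else x ∷ xs) (weak∃?-dual x p) (strong-bound-dual p)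

-- Semantics

module Sem {τ : Signature} (A : Structure τ) where
  open Structure A

  infix 4 _⊩_
  _⊩_ : Assignment A → Formula τ → Set
  s ⊩ φ = _⊨_ A s φ

  infixl 8 _⟨_≔_⟩
  _⟨_≔_⟩ : Assignment A → Var → Universe → Assignment A
  s ⟨ x ≔ a ⟩ = _[_↦_] A s x a

  upd-≡ : ∀ (s : Assignment A) x a → (s ⟨ x ≔ a ⟩) x ≡ a
  upd-≡ s x a = cong (if_then a else s x) (dec-true (x ≟ x) refl)

  upd-≢ : ∀ (s : Assignment A) {x y} a → x ≢ y → (s ⟨ x ≔ a ⟩) y ≡ s y
  upd-≢ s {x} {y} a x≢y = cong (if_then a else s y) (dec-false (x ≟ y) x≢y)

  upd-elim : ∀ {P : Universe → Set} (s : Assignment A) x a y →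
             (x ≡ y → P a) → (x ≢ y → P (s y)) → P ((s ⟨ x ≔ a ⟩) y)
  upd-elim {P} s x a y eq neq with x ≟ y
  ... | yes refl = subst P (sym (upd-≡ s x a)) (eq refl)
  ... | no x≢y   = subst P (sym (upd-≢ s a x≢y)) (neq x≢y)

  upd-cong : ∀ (s t : Assignment A) x a y → (x ≢ y → s y ≡ t y) → (s ⟨ x ≔ a ⟩) y ≡ (t ⟨ x ≔ a ⟩) y
  upd-cong s t x a y eq = upd-elim {P = λ u → u ≡ (t ⟨ x ≔ a ⟩) y} s x a y
    (λ { refl → sym (upd-≡ t x a) }) (λ x≢y → trans (eq x≢y) (sym (upd-≢ t a x≢y)))

  term-cong : ∀ t {s s′ : Assignment A} → (∀ x → x ∈ termVars {τ} t → s x ≡ s′ x) → ⟦_⟧ A t s ≡ ⟦_⟧ A t s′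
  term-cong (var x)   eq = eq x (here refl)
  term-cong (const c) eq = refl
  term-cong (succ t)  eq = cong next (term-cong t eq)

  Holds-cong : ∀ (a : Atom τ) {s s′} → (∀ x → x ∈ atomVars a → s x ≡ s′ x) → Holds A a s ≡ Holds A a s′
  Holds-cong (rel R ts) {s} {s′} eq = cong ⟦ R ⟧ʳ (go ts eq)
    where
    go : ∀ {k} (ts : Vec (Term τ) k) → (∀ x → x ∈ Vec.foldr _ (λ t xs → termVars t ++ xs) [] ts → s x ≡ s′ x) →
         Vec.map (λ t → ⟦_⟧ A t s) ts ≡ Vec.map (λ t → ⟦_⟧ A t s′) ts
    go []       eq = refl
    go (t ∷ ts) eq = cong₂ _∷_ (term-cong t λ x x∈ → eq x (∈-++⁺ˡ x∈)) (go ts λ x x∈ → eq x (∈-++⁺ʳ (termVars t) x∈))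
  Holds-cong (t ≐ u) eq =
    cong₂ _≡_ (term-cong t λ x x∈ → eq x (∈-++⁺ˡ x∈)) (term-cong u λ x x∈ → eq x (∈-++⁺ʳ (termVars t) x∈))

  coincidence : ∀ φ {s s′} → (∀ x → x ∈ free φ → s x ≡ s′ x) → s ⊩ φ → s′ ⊩ φ
  private
    coincidence-quantifier : ∀ x φ a {s s′ : Assignment A} →
      (∀ y → y ∈ filter (λ y → ¬? (y ≟ x)) (free φ) → s y ≡ s′ y) →
      (s ⟨ x ≔ a ⟩) ⊩ φ → (s′ ⟨ x ≔ a ⟩) ⊩ φ
    coincidence-quantifier x φ a {s} {s′} eq = coincidence φ λ y y∈ →
      upd-cong s s′ x a y λ x≢y → eq y (∈-filter⁺ (λ y → ¬? (y ≟ x)) y∈ (x≢y ∘ sym))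
  coincidence (atom a) eq h = subst id (Holds-cong a eq) h
  coincidence (¬ᶠ φ)   eq h = h ∘ coincidence φ (λ x x∈ → sym (eq x x∈))
  coincidence (φ ∧ᶠ ψ) eq (h , k) =
    coincidence φ (λ x x∈ → eq x (∈-++⁺ˡ x∈)) h , coincidence ψ (λ x x∈ → eq x (∈-++⁺ʳ (free φ) x∈)) k
  coincidence (φ ∨ᶠ ψ) eq (inj₁ h) = inj₁ (coincidence φ (λ x x∈ → eq x (∈-++⁺ˡ x∈)) h)
  coincidence (φ ∨ᶠ ψ) eq (inj₂ h) = inj₂ (coincidence ψ (λ x x∈ → eq x (∈-++⁺ʳ (free φ) x∈)) h)
  coincidence (∃ᶠ x φ) eq (a , h) = a , coincidence-quantifier x φ a eq h
  coincidence (∀ᶠ x φ) eq h a     = coincidence-quantifier x φ a eq (h a)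

  ⊩-cong : ∀ φ {s s′} → (∀ x → s x ≡ s′ x) → s ⊩ φ → s′ ⊩ φ
  ⊩-cong φ eq = coincidence φ λ x _ → eq x

  rank-injective : ∀ {a b} → rank a ≡ rank b → a ≡ b
  rank-injective {a} {b} eq = trans (sym (Inverse.strictlyInverseʳ position a))
    (trans (cong (Inverse.from position) (Fin.toℕ-injective eq)) (Inverse.strictlyInverseʳ position b))

  rank≤last : ∀ a → rank a ≤ last
  rank≤last a = Fin.toℕ≤pred[n] (Inverse.to position a)

  -- The sequence saturates at the last element, which is its own successor.
  element : ℕ → Universe
  element zero    = Inverse.from position zero
  element (suc n) = next (element n)

  rank-element : ∀ n → rank (element n) ≡ n ⊓ last
  rank-element zero    = cong toℕ (Inverse.strictlyInverseˡ position zero)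
  rank-element (suc n) = begin
    rank (next (element n))             ≡⟨ cong toℕ (Inverse.strictlyInverseˡ position _) ⟩
    toℕ (fromℕ< (s≤s (m⊓n≤n _ last)))   ≡⟨ Fin.toℕ-fromℕ< _ ⟩
    suc (rank (element n)) ⊓ last       ≡⟨ cong (λ m → suc m ⊓ last) (rank-element n) ⟩
    suc (n ⊓ last) ⊓ last               ≡⟨ saturate n last ⟩
    suc n ⊓ last                        ∎
    where
    open ≡-Reasoning
    saturate : ∀ n l → suc (n ⊓ l) ⊓ l ≡ suc n ⊓ l
    saturate n       zero    = refl
    saturate zero    (suc l) = refl
    saturate (suc n) (suc l) = cong suc (saturate n l)

  rank-element-≤ : ∀ {n} → n ≤ last → rank (element n) ≡ n
  rank-element-≤ {n} n≤ = trans (rank-element n) (m≤n⇒m⊓n≡m n≤)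

  element-rank : ∀ a → element (rank a) ≡ a
  element-rank a = rank-injective (rank-element-≤ (rank≤last a))

  ⟦numeral⟧ : ∀ n s → ⟦_⟧ A (numeral n) s ≡ element n
  ⟦numeral⟧ zero    s = refl
  ⟦numeral⟧ (suc n) s = cong next (⟦numeral⟧ n s)

  _≟ᵘ_ : (a b : Universe) → Dec (a ≡ b)
  a ≟ᵘ b = map′ rank-injective (cong rank) (rank a ≟ rank b)

  ∃ᵘ? : ∀ {P : Universe → Set} → (∀ a → Dec (P a)) → Dec (∃[ a ] P a)
  ∃ᵘ? {P} P? = map′ (λ (i , p) → Inverse.from position i , p)
    (λ (a , p) → Inverse.to position a , subst P (sym (Inverse.strictlyInverseʳ position a)) p)
    (Fin.any? λ i → P? (Inverse.from position i))

  holds? : ∀ a s → Dec (Holds A a s)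
  holds? (rel R ts) s = rel? R (Vec.map (λ t → ⟦_⟧ A t s) ts)
    where
    rel? : ∀ {k} (R : RelSym τ k) as → Dec (⟦ R ⟧ʳ as)
    rel? lt        (a ∷ b ∷ [])     = rank a <? rank b
    rel? add       (a ∷ b ∷ c ∷ []) = rank a + rank b ≟ rank c
    rel? mult      (a ∷ b ∷ c ∷ []) = rank a * rank b ≟ rank c
    rel? (other i) as               = T? (relation i as)
  holds? (t ≐ u) s = ⟦_⟧ A t s ≟ᵘ ⟦_⟧ A u s

  -- Finiteness of the universe makes satisfaction decidable. This gives the classical direction of
  -- duality and lets universal blocks be treated through a negation.
  ⊩? : ∀ φ s → Dec (s ⊩ φ)
  ⊩? (atom a) s = holds? a s
  ⊩? (¬ᶠ φ)   s = ¬? (⊩? φ s)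
  ⊩? (φ ∧ᶠ ψ) s = ⊩? φ s ×-dec ⊩? ψ s
  ⊩? (φ ∨ᶠ ψ) s = ⊩? φ s ⊎-dec ⊩? ψ s
  ⊩? (∃ᶠ x φ) s = ∃ᵘ? λ a → ⊩? φ (s ⟨ x ≔ a ⟩)
  ⊩? (∀ᶠ x φ) s = map′ (λ none a → decidable-stable (⊩? φ (s ⟨ x ≔ a ⟩)) λ n → none (a , n))
    (λ all (a , n) → n (all a)) (¬? (∃ᵘ? λ a → ¬? (⊩? φ (s ⟨ x ≔ a ⟩))))

  dual-sound : ∀ φ {s} → s ⊩ dual φ → ¬ s ⊩ φ
  dual-complete : ∀ φ {s} → ¬ s ⊩ φ → s ⊩ dual φ
  dual-sound (atom a) n h = n h
  dual-sound (¬ᶠ φ)   h n = n h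
  dual-sound (φ ∧ᶠ ψ) (inj₁ h) (k , _) = dual-sound φ h k
  dual-sound (φ ∧ᶠ ψ) (inj₂ h) (_ , k) = dual-sound ψ h k
  dual-sound (φ ∨ᶠ ψ) (h , _) (inj₁ k) = dual-sound φ h k
  dual-sound (φ ∨ᶠ ψ) (_ , h) (inj₂ k) = dual-sound ψ h k
  dual-sound (∃ᶠ x φ) h (a , k) = dual-sound φ (h a) k
  dual-sound (∀ᶠ x φ) (a , h) k = dual-sound φ h (k a)
  dual-complete (atom a) n = n
  dual-complete (¬ᶠ φ) {s} n = decidable-stable (⊩? φ s) n
  dual-complete (φ ∧ᶠ ψ) {s} n with ⊩? φ s
  ... | yes h = inj₂ (dual-complete ψ λ k → n (h , k))
  ... | no ¬h = inj₁ (dual-complete φ ¬h)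
  dual-complete (φ ∨ᶠ ψ) n = dual-complete φ (n ∘ inj₁) , dual-complete ψ (n ∘ inj₂)
  dual-complete (∃ᶠ x φ) n a = dual-complete φ λ h → n (a , h)
  dual-complete (∀ᶠ x φ) {s} n with ∃ᵘ? (λ a → ¬? (⊩? φ (s ⟨ x ≔ a ⟩)))
  ... | yes (a , ¬h) = a , dual-complete φ ¬h
  ... | no none      = contradiction (λ a → decidable-stable (⊩? φ _) λ ¬h → none (a , ¬h)) n

  ⋁-sound : ∀ {X : Set} (f : X → Formula τ) xs {s} → s ⊩ ⋁ (mapˡ f xs) → ∃[ x ] x ∈ xs × s ⊩ f x
  ⋁-sound f []       h        = contradiction refl h
  ⋁-sound f (x ∷ xs) (inj₁ h) = x , here refl , h
  ⋁-sound f (x ∷ xs) (inj₂ h) with y , y∈ , k ← ⋁-sound f xs h = y , there y∈ , k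

  ⋁-complete : ∀ {X : Set} (f : X → Formula τ) {xs s x} → x ∈ xs → s ⊩ f x → s ⊩ ⋁ (mapˡ f xs)
  ⋁-complete f (here refl) h = inj₁ h
  ⋁-complete f (there x∈)  h = inj₂ (⋁-complete f x∈ h)

  ⋀-complete : ∀ {X : Set} (f : X → Formula τ) xs {s} → (∀ {x} → x ∈ xs → s ⊩ f x) → s ⊩ ⋀ (mapˡ f xs)
  ⋀-complete f []       h = refl
  ⋀-complete f (x ∷ xs) h = h (here refl) , ⋀-complete f xs (h ∘ there)

  ⋀-sound : ∀ {X : Set} (f : X → Formula τ) {xs s x} → s ⊩ ⋀ (mapˡ f xs) → x ∈ xs → s ⊩ f x
  ⋀-sound f (h , _) (here refl) = h
  ⋀-sound f (_ , k) (there x∈)  = ⋀-sound f k x∈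

  ⟦subst⟧ᵗ : ∀ σ t s → ⟦_⟧ A (substᵗ σ t) s ≡ ⟦_⟧ A t (λ x → ⟦_⟧ A (σ x) s)
  ⟦subst⟧ᵗ σ (var x)   s = refl
  ⟦subst⟧ᵗ σ (const c) s = refl
  ⟦subst⟧ᵗ σ (succ t)  s = cong next (⟦subst⟧ᵗ σ t s)

  Holds-subst : ∀ σ a s → Holds A (substᵃ σ a) s ≡ Holds A a (λ x → ⟦_⟧ A (σ x) s)
  Holds-subst σ (rel R ts) s = cong ⟦ R ⟧ʳ (go ts)
    where
    go : ∀ {k} (ts : Vec (Term τ) k) → Vec.map (λ t → ⟦_⟧ A t s) (Vec.map (substᵗ σ) ts)
                                    ≡ Vec.map (λ t → ⟦_⟧ A t (λ x → ⟦_⟧ A (σ x) s)) ts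
    go []       = refl
    go (t ∷ ts) = cong₂ _∷_ (⟦subst⟧ᵗ σ t s) (go ts)
  Holds-subst σ (t ≐ u) s = cong₂ _≡_ (⟦subst⟧ᵗ σ t s) (⟦subst⟧ᵗ σ u s)

  ⟦upd⟧ : ∀ σ x t s y → ⟦_⟧ A ((σ [ x ≔ t ]ˢ) y) s ≡ ((λ y → ⟦_⟧ A (σ y) s) ⟨ x ≔ ⟦_⟧ A t s ⟩) y
  ⟦upd⟧ σ x t s y with does (x ≟ y)
  ... | true  = refl
  ... | false = refl

  private
    evaluate : (Var → Term τ) → Assignment A → Assignment A
    evaluate σ s x = ⟦_⟧ A (σ x) s

    evaluate-numeral : ∀ σ x n s y → evaluate (σ [ x ≔ numeral n ]ˢ) s y ≡ (evaluate σ s ⟨ x ≔ element n ⟩) y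
    evaluate-numeral σ x n s y = trans (⟦upd⟧ σ x (numeral n) s y)
      (cong (λ a → (evaluate σ s ⟨ x ≔ a ⟩) y) (⟦numeral⟧ n s))

  module _ {N} (last≤N : last ≤ N) where

    instantiate-sound : ∀ φ σ {s} → s ⊩ instantiate N σ φ → (λ x → ⟦_⟧ A (σ x) s) ⊩ φ
    instantiate-complete : ∀ φ σ {s} → (λ x → ⟦_⟧ A (σ x) s) ⊩ φ → s ⊩ instantiate N σ φ
    instantiate-sound (atom a) σ {s} h = subst id (Holds-subst σ a s) h
    instantiate-sound (¬ᶠ φ)   σ n = n ∘ instantiate-complete φ σ
    instantiate-sound (φ ∧ᶠ ψ) σ (h , k) = instantiate-sound φ σ h , instantiate-sound ψ σ k
    instantiate-sound (φ ∨ᶠ ψ) σ = Sum.map (instantiate-sound φ σ) (instantiate-sound ψ σ)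
    instantiate-sound (∃ᶠ x φ) σ {s} h
      with i , _ , k ← ⋁-sound (λ i → instantiate N (σ [ x ≔ numeral i ]ˢ) φ) (upTo (suc N)) h =
      element i , ⊩-cong φ (evaluate-numeral σ x i s) (instantiate-sound φ _ k)
    instantiate-sound (∀ᶠ x φ) σ {s} h a =
      subst (λ a → (evaluate σ s ⟨ x ≔ a ⟩) ⊩ φ) (element-rank a)
        (⊩-cong φ (evaluate-numeral σ x (rank a) s) (instantiate-sound φ _
          (⋀-sound (λ i → instantiate N (σ [ x ≔ numeral i ]ˢ) φ) h (∈-upTo⁺ (s≤s (≤-trans (rank≤last a) last≤N))))))
    instantiate-complete (atom a) σ {s} h = subst id (sym (Holds-subst σ a s)) h
    instantiate-complete (¬ᶠ φ)   σ n = n ∘ instantiate-sound φ σ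
    instantiate-complete (φ ∧ᶠ ψ) σ (h , k) = instantiate-complete φ σ h , instantiate-complete ψ σ k
    instantiate-complete (φ ∨ᶠ ψ) σ = Sum.map (instantiate-complete φ σ) (instantiate-complete ψ σ)
    instantiate-complete (∃ᶠ x φ) σ {s} (a , h) =
      ⋁-complete (λ i → instantiate N (σ [ x ≔ numeral i ]ˢ) φ) (∈-upTo⁺ (s≤s (≤-trans (rank≤last a) last≤N)))
        (instantiate-complete φ _ (⊩-cong φ (λ y → sym (evaluate-numeral σ x (rank a) s y))
          (subst (λ a → (evaluate σ s ⟨ x ≔ a ⟩) ⊩ φ) (sym (element-rank a)) h)))
    instantiate-complete (∀ᶠ x φ) σ {s} h =
      ⋀-complete (λ i → instantiate N (σ [ x ≔ numeral i ]ˢ) φ) (upTo (suc N)) λ {i} _ →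
        instantiate-complete φ _ (⊩-cong φ (λ y → sym (evaluate-numeral σ x i s y)) (h (element i)))

  module _ {ι : Var → Var} (ι-injective : ∀ {x y} → ι x ≡ ι y → x ≡ y) where

    private
      upd-rename : ∀ s x a y → (s ⟨ ι x ≔ a ⟩) (ι y) ≡ ((s ∘ ι) ⟨ x ≔ a ⟩) y
      upd-rename s x a y = upd-elim {P = λ u → u ≡ ((s ∘ ι) ⟨ x ≔ a ⟩) y} s (ι x) a (ι y)
        (λ eq → subst (λ y → a ≡ ((s ∘ ι) ⟨ x ≔ a ⟩) y) (ι-injective eq) (sym (upd-≡ (s ∘ ι) x a)))
        (λ neq → sym (upd-≢ (s ∘ ι) a (neq ∘ cong ι)))

    rename-sound : ∀ φ {s} → s ⊩ rename ι φ → (s ∘ ι) ⊩ φ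
    rename-complete : ∀ φ {s} → (s ∘ ι) ⊩ φ → s ⊩ rename ι φ
    rename-sound (atom a) {s} h = subst id (Holds-subst (var ∘ ι) a s) h
    rename-sound (¬ᶠ φ)   n = n ∘ rename-complete φ
    rename-sound (φ ∧ᶠ ψ) (h , k) = rename-sound φ h , rename-sound ψ k
    rename-sound (φ ∨ᶠ ψ) = Sum.map (rename-sound φ) (rename-sound ψ)
    rename-sound (∃ᶠ x φ) {s} (a , h) = a , ⊩-cong φ (upd-rename s x a) (rename-sound φ h)
    rename-sound (∀ᶠ x φ) {s} h a = ⊩-cong φ (upd-rename s x a) (rename-sound φ (h a))
    rename-complete (atom a) {s} h = subst id (sym (Holds-subst (var ∘ ι) a s)) h
    rename-complete (¬ᶠ φ)   n = n ∘ rename-sound φ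
    rename-complete (φ ∧ᶠ ψ) (h , k) = rename-complete φ h , rename-complete ψ k
    rename-complete (φ ∨ᶠ ψ) = Sum.map (rename-complete φ) (rename-complete ψ)
    rename-complete (∃ᶠ x φ) {s} (a , h) = a , rename-complete φ (⊩-cong φ (λ y → sym (upd-rename s x a y)) h)
    rename-complete (∀ᶠ x φ) {s} h a = rename-complete φ (⊩-cong φ (λ y → sym (upd-rename s x a y)) (h a))

-- Colour coding

-- nothing: the variable has its ordinary value; just j: it is bound by a weak quantifier of colour j.
Colouring : Set
Colouring = Var → Maybe ℕ

_[_≔_]ᶜ : Colouring → Var → Maybe ℕ → Colouring
(ρ [ x ≔ v ]ᶜ) y = if does (x ≟ y) then v else ρ y

-- Colours are handed out by a counter `n`: the weak quantifiers inside a subformula `φ` visited at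
-- `n` get colours from `n` up to below `n + size φ`, and those above it have colours below `n`.
Below : Colouring → ℕ → Set
Below ρ n = ∀ {x j} → ρ x ≡ just j → j < n

colour-≡ : ∀ ρ x v → (ρ [ x ≔ v ]ᶜ) x ≡ v
colour-≡ ρ x v = cong (if_then v else ρ x) (dec-true (x ≟ x) refl)

colour-≢ : ∀ ρ {x y} v → x ≢ y → (ρ [ x ≔ v ]ᶜ) y ≡ ρ y
colour-≢ ρ {x} {y} v x≢y = cong (if_then v else ρ y) (dec-false (x ≟ y) x≢y)

colour-elim : ∀ (P : Var → ℕ → Set) ρ x v → (∀ {j} → v ≡ just j → P x j) →
              (∀ {y j} → x ≢ y → ρ y ≡ just j → P y j) → ∀ {y j} → (ρ [ x ≔ v ]ᶜ) y ≡ just j → P y j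
colour-elim P ρ x v new old {y} eq with x ≟ y
... | yes refl = new (trans (sym (colour-≡ ρ x v)) eq)
... | no x≢y   = old x≢y (trans (sym (colour-≢ ρ v x≢y)) eq)

module _ {τ : Signature} where

  -- A common bound for the number of colours and the number of inequalities of a skeleton, so that
  -- a single `K` serves in `hashing`.
  size : Formula τ → ℕ
  size (atom a) = 1
  size (¬ᶠ φ)   = size φ
  size (φ ∧ᶠ ψ) = suc (size φ + size ψ)
  size (φ ∨ᶠ ψ) = suc (size φ + size ψ)
  size (∃ᶠ x φ) = suc (size φ)
  size (∀ᶠ x φ) = suc (size φ)

  Essential : Var → Formula τ → Set
  Essential x φ = Any (∃-Essential x) (scope x φ)

  Weak-∧ˡ : ∀ {x} {α β : Formula τ} → Weak∃ x (α ∧ᶠ β) → Weak∃ x α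
  Weak-∧ˡ w = w ∘ Sum.map (there ∘ Any.++⁺ˡ) (there ∘ Any.++⁺ˡ)

  Weak-∧ʳ : ∀ {x} {α β : Formula τ} → Weak∃ x (α ∧ᶠ β) → Weak∃ x β
  Weak-∧ʳ {x} {α} w = w ∘ Sum.map (there ∘ Any.++⁺ʳ (scope x α)) (there ∘ Any.++⁺ʳ (scope x α))

  Weak-∨ˡ : ∀ {x} {α β : Formula τ} → Weak∃ x (α ∨ᶠ β) → Weak∃ x α
  Weak-∨ˡ w = w ∘ Sum.map (there ∘ Any.++⁺ˡ) (there ∘ Any.++⁺ˡ)

  Weak-∨ʳ : ∀ {x} {α β : Formula τ} → Weak∃ x (α ∨ᶠ β) → Weak∃ x β
  Weak-∨ʳ {x} {α} w = w ∘ Sum.map (there ∘ Any.++⁺ʳ (scope x α)) (there ∘ Any.++⁺ʳ (scope x α))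

  Any-scope-∃ : ∀ {P : Formula τ → Set} {x y ψ} → x ≢ y → Any P (scope x ψ) → Any P (scope x (∃ᶠ y ψ))
  Any-scope-∃ {P} {x} {y} {ψ} x≢y any =
    there (subst (λ b → Any P (if b then [] else scope x ψ)) (sym (dec-false (x ≟ y) x≢y)) any)

  Weak-∃ : ∀ {x y} {ψ : Formula τ} → x ≢ y → Weak∃ x (∃ᶠ y ψ) → Weak∃ x ψ
  Weak-∃ x≢y w = w ∘ Sum.map (Any-scope-∃ x≢y) (Any-scope-∃ x≢y)

  -- A skeleton of φ selects one disjunct of every disjunction that lies outside all universal
  -- quantifiers. B collects the variables bound by strong quantifiers above; a universal subformula
  -- is inner if it depends on one of them, and otherwise it can be evaluated outside of φ.
  data Skeleton : List Var → Formula τ → Set where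
    pos    : ∀ {B} a → Skeleton B (atom a)
    neg    : ∀ {B} a → (∀ x → ¬ VarEquation x a) → Skeleton B (¬ᶠ atom a)
    neq    : ∀ {B} y z → Skeleton B (¬ᶠ atom (var y ≐ var z))
    both   : ∀ {B α β} → Skeleton B α → Skeleton B β → Skeleton B (α ∧ᶠ β)
    left   : ∀ {B α β} → Skeleton B α → Skeleton B (α ∨ᶠ β)
    right  : ∀ {B α β} → Skeleton B β → Skeleton B (α ∨ᶠ β)
    weak   : ∀ {B} x {ψ} → Weak∃ x ψ → Skeleton B ψ → Skeleton B (∃ᶠ x ψ)
    strong : ∀ {B} x {ψ} → ¬ Weak∃ x ψ → Skeleton (x ∷ B) ψ → Skeleton B (∃ᶠ x ψ)
    inner  : ∀ {B x ψ} → NNF ψ → Any (_∈ B) (free (∀ᶠ x ψ)) → Skeleton B (∀ᶠ x ψ)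
    outer  : ∀ {B x ψ} → NNF ψ → ¬ Any (_∈ B) (free (∀ᶠ x ψ)) → Skeleton B (∀ᶠ x ψ)

  -- Inequalities between variables are the literals that weakness tolerates any number of times,
  -- hence a case of their own; in every other negated atom all variables are essential.
  data NegatedAtom : Atom τ → Set where
    inequality : ∀ y z → NegatedAtom (var y ≐ var z)
    generic    : ∀ {a} → (∀ x → ¬ VarEquation x a) → NegatedAtom a

  negatedAtom : ∀ a → NegatedAtom a
  negatedAtom (var y ≐ var z)   = inequality y z
  negatedAtom (rel _ _)         = generic λ _ ()
  negatedAtom (var _ ≐ const _) = generic λ _ ()
  negatedAtom (var _ ≐ succ _)  = generic λ _ ()
  negatedAtom (const _ ≐ _)     = generic λ _ ()
  negatedAtom (succ _ ≐ _)      = generic λ _ ()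

  negatedSkeleton : ∀ {B a} → NegatedAtom a → Skeleton B (¬ᶠ atom a)
  negatedSkeleton (inequality y z) = neq y z
  negatedSkeleton (generic ¬eq)    = neg _ ¬eq

  skeletons : ∀ B {φ} → NNF φ → List (Skeleton B φ)
  existentialSkeletons : ∀ B {x φ} → NNF φ → Dec (Weak∃ x φ) → List (Skeleton B (∃ᶠ x φ))
  universalSkeletons : ∀ B {x φ} → NNF φ → Dec (Any (_∈ B) (free (∀ᶠ x φ))) → List (Skeleton B (∀ᶠ x φ))
  skeletons B (pos a)      = [ pos a ]
  skeletons B (neg a)      = [ negatedSkeleton (negatedAtom a) ]
  skeletons B (p ∧ᶠ q)     = cartesianProductWith both (skeletons B p) (skeletons B q)
  skeletons B (p ∨ᶠ q)     = mapˡ left (skeletons B p) ++ mapˡ right (skeletons B q)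
  skeletons B (∃ᶠ x {φ} p) = existentialSkeletons B p (weak∃? x φ)
  skeletons B (∀ᶠ x {φ} p) = universalSkeletons B p (Any.any? (_∈? B) (free (∀ᶠ x φ)))
  existentialSkeletons B {x} p (yes w)  = mapˡ (weak x w) (skeletons B p)
  existentialSkeletons B {x} p (no ¬w)  = mapˡ (strong x ¬w) (skeletons (x ∷ B) p)
  universalSkeletons B p (yes i) = [ inner p i ]
  universalSkeletons B p (no ¬i) = [ outer p ¬i ]

  AllWeak : Colouring → Formula τ → Set
  AllWeak ρ φ = ∀ {x j} → ρ x ≡ just j → Weak∃ x φ

-- Soundness and completeness of colour coding for one skeleton

module Blocks {τ : Signature} (A : Structure τ) where
  open Structure A
  open Sem A

  Sat : ∀ {B φ} → Skeleton B φ → Assignment A → Set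
  Sat {φ = φ} (pos _)   s = s ⊩ φ
  Sat {φ = φ} (neg _ _) s = s ⊩ φ
  Sat {φ = φ} (neq _ _) s = s ⊩ φ
  Sat (both k l)        s = Sat k s × Sat l s
  Sat (left k)          s = Sat k s
  Sat (right k)         s = Sat k s
  Sat (weak x _ k)      s = ∃[ a ] Sat k (s ⟨ x ≔ a ⟩)
  Sat (strong x _ k)    s = ∃[ a ] Sat k (s ⟨ x ≔ a ⟩)
  Sat {φ = φ} (inner _ _) s = s ⊩ φ
  Sat {φ = φ} (outer _ _) s = s ⊩ φ

  Sat-cong : ∀ {B φ} (k : Skeleton B φ) {s s′} → (∀ x → s x ≡ s′ x) → Sat k s → Sat k s′
  Sat-cong {φ = φ} (pos _)     eq h = ⊩-cong φ eq h
  Sat-cong {φ = φ} (neg _ _)   eq h = ⊩-cong φ eq h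
  Sat-cong {φ = φ} (neq _ _)   eq h = ⊩-cong φ eq h
  Sat-cong (both k l)          eq (h , i) = Sat-cong k eq h , Sat-cong l eq i
  Sat-cong (left k)            eq h = Sat-cong k eq h
  Sat-cong (right k)           eq h = Sat-cong k eq h
  Sat-cong (weak x _ k) {s} {s′}   eq (a , h) = a , Sat-cong k (λ y → upd-cong s s′ x a y λ _ → eq y) h
  Sat-cong (strong x _ k) {s} {s′} eq (a , h) = a , Sat-cong k (λ y → upd-cong s s′ x a y λ _ → eq y) h
  Sat-cong {φ = φ} (inner _ _) eq h = ⊩-cong φ eq h
  Sat-cong {φ = φ} (outer _ _) eq h = ⊩-cong φ eq h

  Sat-complete : ∀ B {φ} (p : NNF φ) {s} → s ⊩ φ → ∃[ k ] k ∈ skeletons B p × Sat k s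
  Sat-complete B (pos a) h = pos a , here refl , h
  Sat-complete B (neg a) {s} h = negatedSkeleton (negatedAtom a) , here refl , go (negatedAtom a)
    where
    go : (n : NegatedAtom a) → Sat (negatedSkeleton {B = B} n) s
    go (inequality y z) = h
    go (generic _)      = h
  Sat-complete B (p ∧ᶠ q) (h , i)
    with k , k∈ , hk ← Sat-complete B p h | l , l∈ , il ← Sat-complete B q i =
    both k l , ∈-cartesianProductWith⁺ both k∈ l∈ , hk , il
  Sat-complete B (p ∨ᶠ q) (inj₁ h) with k , k∈ , hk ← Sat-complete B p h =
    left k , ∈-++⁺ˡ (∈-map⁺ left k∈) , hk
  Sat-complete B (p ∨ᶠ q) (inj₂ h) with k , k∈ , hk ← Sat-complete B q h =
    right k , ∈-++⁺ʳ (mapˡ left (skeletons B p)) (∈-map⁺ right k∈) , hk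
  Sat-complete B (∃ᶠ x {φ} p) {s} (a , h) = go (weak∃? x φ)
    where
    go : (d : Dec (Weak∃ x φ)) → ∃[ k ] k ∈ existentialSkeletons B p d × Sat k s
    go (yes w) with k , k∈ , hk ← Sat-complete B p h = weak x w k , ∈-map⁺ (weak x w) k∈ , a , hk
    go (no ¬w) with k , k∈ , hk ← Sat-complete (x ∷ B) p h = strong x ¬w k , ∈-map⁺ (strong x ¬w) k∈ , a , hk
  Sat-complete B (∀ᶠ x {φ} p) {s} h = go (Any.any? (_∈? B) (free (∀ᶠ x φ)))
    where
    go : (d : Dec (Any (_∈ B) (free (∀ᶠ x φ)))) → ∃[ k ] k ∈ universalSkeletons B p d × Sat k s
    go (yes i) = inner p i , here refl , h
    go (no ¬i) = outer p ¬i , here refl , h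

  Classes : Set₁
  Classes = ℕ → Universe → Set

  Possible : Classes → Maybe ℕ → Universe → Universe → Set
  Possible C r a u = maybe′ (λ j → C j u) (u ≡ a) r

  Fits : Classes → Colouring → Assignment A → Assignment A → Set
  Fits C ρ s m = ∀ x → Possible C (ρ x) (s x) (m x)

  Witnessed : Classes → Colouring → Assignment A → List Var → Formula τ → Set
  Witnessed C ρ s xs ℓ = ∃[ m ] (∀ x → x ∈ xs → Possible C (ρ x) (s x) (m x)) × m ⊩ ℓ

  -- What the colour classes C retain of a skeleton: weakly bound variables are chosen from their
  -- classes at each literal separately, and inequalities become disjointness.
  Coloured : ∀ {B φ} → Skeleton B φ → Classes → Colouring → ℕ → Assignment A → Set
  Coloured (pos a)      C ρ n s = Witnessed C ρ s (atomVars a) (atom a)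
  Coloured (neg a _)    C ρ n s = Witnessed C ρ s (atomVars a) (¬ᶠ atom a)
  Coloured (neq y z)    C ρ n s = ¬ (∃[ u ] Possible C (ρ y) (s y) u × Possible C (ρ z) (s z) u)
  Coloured {φ = α ∧ᶠ β} (both k l) C ρ n s = Coloured k C ρ n s × Coloured l C ρ (n + size α) s
  Coloured (left k)     C ρ n s = Coloured k C ρ n s
  Coloured (right k)    C ρ n s = Coloured k C ρ n s
  Coloured (weak x _ k) C ρ n s = Coloured k C (ρ [ x ≔ just n ]ᶜ) (suc n) s
  Coloured (strong x _ k) C ρ n s = ∃[ a ] Coloured k C (ρ [ x ≔ nothing ]ᶜ) n (s ⟨ x ≔ a ⟩)
  Coloured {φ = φ} (inner _ _) C ρ n s = s ⊩ φ
  Coloured (outer _ _)  C ρ n s = ⊤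

  -- Outer universal subformulas are read at the assignment in front of the block. Their free
  -- variables are not strongly bound above, by the definition of `outer`, and not weakly bound,
  -- since no universal quantifier depends on a weak variable.
  Guard : ∀ {B φ} → Skeleton B φ → Assignment A → Set
  Guard (pos a)        s = ⊤
  Guard (neg a _)      s = ⊤
  Guard (neq y z)      s = ⊤
  Guard (both k l)     s = Guard k s × Guard l s
  Guard (left k)       s = Guard k s
  Guard (right k)      s = Guard k s
  Guard (weak _ _ k)   s = Guard k s
  Guard (strong _ _ k) s = Guard k s
  Guard (inner _ _)    s = ⊤
  Guard {φ = φ} (outer _ _) s = s ⊩ φ

  Agree : List Var → Assignment A → Assignment A → Set
  Agree B s s₀ = ∀ {x} → x ∉ B → s x ≡ s₀ x

  Agree-upd : ∀ {B s s₀ x} a → Agree B s s₀ → Agree (x ∷ B) (s ⟨ x ≔ a ⟩) s₀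
  Agree-upd {s = s} a agree y∉ = trans (upd-≢ s a (λ x≡y → y∉ (here (sym x≡y)))) (agree (y∉ ∘ there))

  Possible-value : ∀ C {r a u v} → r ≡ nothing → Possible C r a u → Possible C r a v → u ≡ v
  Possible-value _ refl p q = trans p (sym q)

  -- m satisfies φ, and keeps doing so if the values at inessential variables change within their classes.
  Robust : Classes → Colouring → Assignment A → Formula τ → Assignment A → Set
  Robust C ρ s φ m = ∀ m′ → Fits C ρ s m′ → (∀ x → Essential x φ → m′ x ≡ m x) → m′ ⊩ φ

  module _ (C : Classes) (s₀ : Assignment A) where

    -- A weakly bound variable may occur in no essential literal of the skeleton; it needs a witness
    -- all the same.
    Nonempty : ℕ → Set
    Nonempty n = ∀ {j} → j < n → ∃[ u ] C j u

    default : ∀ {ρ n} (s : Assignment A) → Below ρ n → Nonempty n → ∀ x → ∃[ u ] Possible C (ρ x) (s x) u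
    default {ρ} s below ne x with ρ x in eq
    ... | nothing = s x , refl
    ... | just j  = ne (below {x} eq)

    literal-robust : ∀ {ρ n s} ℓ → Below ρ n → Nonempty n → (∀ x → x ∈ free ℓ → Essential x ℓ) →
                     Witnessed C ρ s (free ℓ) ℓ → ∃[ m ] Fits C ρ s m × Robust C ρ s ℓ m
    literal-robust {ρ} {n} {s} ℓ below ne ess (m , fits , h) = m⁺ , fits⁺ , robust
      where
      fill : ∀ x → Dec (x ∈ free ℓ) → ∃[ u ] Possible C (ρ x) (s x) u × (x ∈ free ℓ → u ≡ m x)
      fill x (yes x∈) = m x , fits x x∈ , λ _ → refl
      fill x (no x∉)  = let u , p = default {ρ} s below ne x in u , p , λ x∈ → contradiction x∈ x∉
      m⁺ : Assignment A
      m⁺ x = proj₁ (fill x (x ∈? free ℓ))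
      fits⁺ : Fits C ρ s m⁺
      fits⁺ x = proj₁ (proj₂ (fill x (x ∈? free ℓ)))
      robust : Robust C ρ s ℓ m⁺
      robust m′ _ eq = coincidence ℓ
        (λ x x∈ → sym (trans (eq x (ess x x∈)) (proj₂ (proj₂ (fill x (x ∈? free ℓ))) x∈))) h

    -- Outside the quantifier the name `y` is another variable and inessential for `∃ᶠ y φ`. So its
    -- value is reset to an arbitrary possible one, and `m y` becomes the witness. Weak and strong
    -- quantifiers are both covered, as they change `ρ` and `s` at `y` only.
    quantifier-robust : ∀ {ρ ρ′ n s s′ y φ} → Below ρ n → Nonempty n →
      (∀ {x} → y ≢ x → ρ′ x ≡ ρ x) → (∀ {x} → y ≢ x → s′ x ≡ s x) →
      ∃[ m ] Fits C ρ′ s′ m × Robust C ρ′ s′ φ m →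
      ∃[ m ] Fits C ρ s m × Robust C ρ s (∃ᶠ y φ) m
    quantifier-robust {ρ} {ρ′} {n} {s} {s′} {y} {φ} below ne ρ≡ s≡ (m , fits , robust) =
      m ⟨ y ≔ u ⟩ , fits′ , robust′
      where
      u = proj₁ (default {ρ} s below ne y)
      fits′ : Fits C ρ s (m ⟨ y ≔ u ⟩)
      fits′ x = upd-elim {P = Possible C (ρ x) (s x)} m y u x (λ { refl → proj₂ (default {ρ} s below ne y) })
        (λ y≢x → subst (λ r → Possible C r (s x) (m x)) (ρ≡ y≢x)
          (subst (λ a → Possible C (ρ′ x) a (m x)) (s≡ y≢x) (fits x)))
      robust′ : Robust C ρ s (∃ᶠ y φ) (m ⟨ y ≔ u ⟩)
      robust′ m′ fits″ eq = m y , robust (m′ ⟨ y ≔ m y ⟩)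
        (λ x → upd-elim {P = Possible C (ρ′ x) (s′ x)} m′ y (m y) x (λ { refl → fits x })
          (λ y≢x → subst (λ r → Possible C r (s′ x) (m′ x)) (sym (ρ≡ y≢x))
            (subst (λ a → Possible C (ρ x) a (m′ x)) (sym (s≡ y≢x)) (fits″ x))))
        (λ x ess → upd-elim {P = λ v → v ≡ m x} m′ y (m y) x (λ { refl → refl })
          (λ y≢x → trans (eq x (Any-scope-∃ {ψ = φ} (y≢x ∘ sym) ess)) (upd-≢ m u y≢x)))

    -- The gluing step. By weakness a coloured variable is essential for at most one conjunct and
    -- takes its value from the assignment for that conjunct. At uncoloured variables `m₁` and `m₂`
    -- agree, since only one value is possible there.
    both-robust : ∀ {ρ s α β} → AllWeak ρ (α ∧ᶠ β) →
      ∃[ m ] Fits C ρ s m × Robust C ρ s α m → ∃[ m ] Fits C ρ s m × Robust C ρ s β m →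
      ∃[ m ] Fits C ρ s m × Robust C ρ s (α ∧ᶠ β) m
    both-robust {ρ} {s} {α} {β} allWeak (m₁ , fits₁ , robust₁) (m₂ , fits₂ , robust₂) =
      m , fits , λ m′ fits′ eq → robust₁ m′ fits′ (agree₁ m′ eq) , robust₂ m′ fits′ (agree₂ m′ fits′ eq)
      where
      essential? : ∀ x → Dec (Essential x α)
      essential? x = Any.any? (∃-essential? x) (scope x α)
      m : Assignment A
      m x = if does (essential? x) then m₁ x else m₂ x
      fits : Fits C ρ s m
      fits x with does (essential? x)
      ... | true  = fits₁ x
      ... | false = fits₂ x
      agree₁ : ∀ m′ → (∀ x → Essential x (α ∧ᶠ β) → m′ x ≡ m x) → ∀ x → Essential x α → m′ x ≡ m₁ x
      agree₁ m′ eq x e = trans (eq x (there (Any.++⁺ˡ e)))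
        (cong (if_then m₁ x else m₂ x) (dec-true (essential? x) e))
      agree₂ : ∀ m′ → Fits C ρ s m′ → (∀ x → Essential x (α ∧ᶠ β) → m′ x ≡ m x) →
               ∀ x → Essential x β → m′ x ≡ m₂ x
      agree₂ m′ fits′ eq x e with ρ x in ρx
      ... | nothing = Possible-value C ρx (fits′ x) (fits₂ x)
      ... | just _  = trans (eq x (there (Any.++⁺ʳ (scope x α) e))) (cong (if_then m₁ x else m₂ x)
        (dec-false (essential? x) λ e′ → allWeak ρx (inj₂ (here (e′ , e)))))

    Coloured-robust : ∀ {B φ} (k : Skeleton B φ) {ρ n s} → Below ρ n → AllWeak ρ φ → Nonempty (n + size φ) →
      Agree B s s₀ → Guard k s₀ → Coloured k C ρ n s → ∃[ m ] Fits C ρ s m × Robust C ρ s φ m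
    Coloured-robust (pos a) below aw ne agree g t =
      literal-robust (atom a) (λ eq → m≤n⇒m≤n+o 1 (below eq)) ne (λ _ → here) t
    Coloured-robust (neg a ¬eq) below aw ne agree g t =
      literal-robust (¬ᶠ atom a) (λ eq → m≤n⇒m≤n+o 1 (below eq)) ne (λ x x∈ → here (x∈ , ¬eq x)) t
    -- An inequality has no essential variable: since the two classes are disjoint, it holds at
    -- every assignment that fits, so default values will do.
    Coloured-robust (neq y z) {ρ} {s = s} below aw ne agree g t =
      proj₁ ∘ def , proj₂ ∘ def , λ m′ fits′ _ eq → t (m′ y , fits′ y , subst (Possible C (ρ z) (s z)) (sym eq) (fits′ z))
      where
      def : ∀ x → ∃[ u ] Possible C (ρ x) (s x) u
      def = default s (λ eq → m≤n⇒m≤n+o 1 (below eq)) ne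
    Coloured-robust {φ = α ∧ᶠ β} (both k l) {n = n} below aw ne agree (g , g′) (t , t′) =
      both-robust {α = α} {β} aw
        (Coloured-robust k below (λ eq → Weak-∧ˡ {α = α} {β} (aw eq))
          (λ j< → ne (<-≤-trans j< (+-monoʳ-≤ n (m≤n⇒m≤1+n (m≤m+n (size α) (size β)))))) agree g t)
        (Coloured-robust l (λ eq → m≤n⇒m≤n+o (size α) (below eq)) (λ eq → Weak-∧ʳ {α = α} {β} (aw eq))
          (λ {j} j< → ne (<-≤-trans (subst (j <_) (+-assoc n (size α) (size β)) j<) (+-monoʳ-≤ n (n≤1+n _)))) agree g′ t′)
    Coloured-robust {φ = α ∨ᶠ β} (left k) {n = n} below aw ne agree g t
      with m , fits , robust ← Coloured-robust k below (λ eq → Weak-∨ˡ {α = α} {β} (aw eq))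
             (λ j< → ne (<-≤-trans j< (+-monoʳ-≤ n (m≤n⇒m≤1+n (m≤m+n (size α) (size β)))))) agree g t =
      m , fits , λ m′ fits′ eq → inj₁ (robust m′ fits′ λ x e → eq x (there (Any.++⁺ˡ e)))
    Coloured-robust {φ = α ∨ᶠ β} (right k) {n = n} below aw ne agree g t
      with m , fits , robust ← Coloured-robust k below (λ eq → Weak-∨ʳ {α = α} {β} (aw eq))
             (λ j< → ne (<-≤-trans j< (+-monoʳ-≤ n (m≤n⇒m≤1+n (m≤n+m (size β) (size α)))))) agree g t =
      m , fits , λ m′ fits′ eq → inj₂ (robust m′ fits′ λ x e → eq x (there (Any.++⁺ʳ (scope x α) e)))
    Coloured-robust (weak y {φ} w k) {ρ} {n} {s} below aw ne agree g t =
      quantifier-robust {φ = φ} (λ eq → <-≤-trans (below eq) (m≤m+n n _)) ne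
        (colour-≢ ρ (just n)) (λ _ → refl)
        (Coloured-robust k
          (colour-elim (λ _ j → j < suc n) ρ y (just n) (λ { refl → n<1+n n }) (λ _ eq → m<n⇒m<1+n (below eq)))
          (colour-elim (λ x _ → Weak∃ x φ) ρ y (just n) (λ _ → w) (λ y≢x eq → Weak-∃ {ψ = φ} (y≢x ∘ sym) (aw eq)))
          (λ {j} j< → ne (subst (j <_) (sym (+-suc n (size φ))) j<)) agree g t)
    Coloured-robust (strong y {φ} ¬w k) {ρ} {n} {s} below aw ne agree g (a , t) =
      quantifier-robust {φ = φ} (λ eq → <-≤-trans (below eq) (m≤m+n n _)) ne
        (colour-≢ ρ nothing) (upd-≢ s a)
        (Coloured-robust k
          (colour-elim (λ _ j → j < n) ρ y nothing (λ ()) (λ _ eq → below eq))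
          (colour-elim (λ x _ → Weak∃ x φ) ρ y nothing (λ ()) (λ y≢x eq → Weak-∃ {ψ = φ} (y≢x ∘ sym) (aw eq)))
          (λ {j} j< → ne (<-≤-trans j< (+-monoʳ-≤ n (n≤1+n (size φ))))) (Agree-upd a agree) g t)
    -- By weakness no coloured variable is free in a universal subformula, and `s` determines the
    -- values of the uncoloured ones.
    Coloured-robust {φ = φ} (inner _ _) {ρ} {n} {s} below aw ne agree g t =
      proj₁ ∘ def , proj₂ ∘ def , λ m′ fits′ _ → coincidence φ (λ x x∈ → sym (ordinary m′ fits′ x x∈)) t
      where
      def : ∀ x → ∃[ u ] Possible C (ρ x) (s x) u
      def = default s (λ eq → <-≤-trans (below eq) (m≤m+n n _)) ne
      ordinary : ∀ m′ → Fits C ρ s m′ → ∀ x → x ∈ free φ → m′ x ≡ s x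
      ordinary m′ fits′ x x∈ with ρ x in ρx
      ... | nothing = Possible-value C ρx (fits′ x) (subst (λ r → Possible C r (s x) (s x)) (sym ρx) refl)
      ... | just _  = contradiction (inj₁ (here x∈)) (aw ρx)
    Coloured-robust {B} {φ} (outer _ ¬i) {ρ} {n} {s} below aw ne agree g t =
      proj₁ ∘ def , proj₂ ∘ def , λ m′ fits′ _ → coincidence φ (λ x x∈ → sym (ordinary m′ fits′ x x∈)) g
      where
      def : ∀ x → ∃[ u ] Possible C (ρ x) (s x) u
      def = default s (λ eq → <-≤-trans (below eq) (m≤m+n n _)) ne
      ordinary : ∀ m′ → Fits C ρ s m′ → ∀ x → x ∈ free φ → m′ x ≡ s₀ x
      ordinary m′ fits′ x x∈ with ρ x in ρx
      ... | nothing = trans (Possible-value C ρx (fits′ x) (subst (λ r → Possible C r (s x) (s x)) (sym ρx) refl))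
                            (agree λ x∈B → ¬i (lose x∈ x∈B))
      ... | just _  = contradiction (inj₁ (here x∈)) (aw ρx)

    -- At the top nothing is coloured, so an assignment that fits is `s₀` itself.
    Coloured-sound : ∀ {φ} (k : Skeleton [] φ) → Nonempty (size φ) → Guard k s₀ →
                     Coloured k C (λ _ → nothing) 0 s₀ → s₀ ⊩ φ
    Coloured-sound {φ} k ne g t
      with m , fits , robust ← Coloured-robust k (λ ()) (λ ()) ne (λ _ → refl) g t =
      ⊩-cong φ fits (robust m fits λ _ _ → refl)

  look : (ℕ → Universe) → Assignment A → Colouring → Assignment A
  look h s ρ x = maybe′ h (s x) (ρ x)

  Distinct : List (Universe × Universe) → Set
  Distinct = All (λ (u , v) → u ≢ v)

  -- A choice of witnesses h together with the finitely many inequalities D it relies on: every family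
  -- of classes that is a fibre of a function f separating D can serve as a colouring.
  record Plan {B φ} (k : Skeleton B φ) (ρ : Colouring) (n : ℕ) (s s₀ : Assignment A) (h : ℕ → Universe) : Set₁ where
    field
      witness  : ℕ → Universe
      pairs    : List (Universe × Universe)
      extends  : ∀ {j} → j < n → witness j ≡ h j
      few      : length pairs ≤ size φ
      distinct : Distinct pairs
      guard    : Guard k s₀
      realise  : ∀ (C : Classes) (f : Universe → ℕ) →
                 (∀ {j u} → j < n + size φ → C j u ⇔ f u ≡ f (witness j)) →
                 All (λ (u , v) → f u ≢ f v) pairs → Coloured k C ρ n s

  open Plan

  module _ (s₀ : Assignment A) where

    literal-witnessed : ∀ {ρ n s} {h : ℕ → Universe} ℓ (C : Classes) (f : Universe → ℕ) → Below ρ n →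
      (∀ {j u} → j < n → C j u ⇔ f u ≡ f (h j)) → look h s ρ ⊩ ℓ → Witnessed C ρ s (free ℓ) ℓ
    literal-witnessed {ρ} {n} {s} {h} ℓ C f below C⇔ t = look h s ρ , (λ x _ → possible x) , t
      where
      possible : ∀ x → Possible C (ρ x) (s x) (look h s ρ x)
      possible x with ρ x in ρx
      ... | nothing = refl
      ... | just j  = from (C⇔ (below ρx)) refl

    possible-fibre : ∀ {ρ n s} {h : ℕ → Universe} (C : Classes) (f : Universe → ℕ) → Below ρ n →
      (∀ {j u} → j < n → C j u ⇔ f u ≡ f (h j)) → ∀ x {u} → Possible C (ρ x) (s x) u → f u ≡ f (look h s ρ x)
    possible-fibre {ρ} C f below C⇔ x p with ρ x in ρx
    ... | nothing = cong f p
    ... | just j  = to (C⇔ (below ρx)) p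

    -- Colours and variables are both natural numbers, so the update of assignments also records the
    -- witness `a` under the colour `n`.
    look-weak : ∀ {ρ n} h s y a → Below ρ n → ∀ x →
                (look h s ρ ⟨ y ≔ a ⟩) x ≡ look (h ⟨ n ≔ a ⟩) s (ρ [ y ≔ just n ]ᶜ) x
    look-weak {ρ} {n} h s y a below x with does (y ≟ x)
    ... | true  = sym (upd-≡ h n a)
    ... | false with ρ x in ρx
    ...   | nothing = refl
    ...   | just j  = sym (upd-≢ h a (<⇒≢ (below ρx) ∘ sym))

    look-strong : ∀ ρ h s y a x → (look h s ρ ⟨ y ≔ a ⟩) x ≡ look h (s ⟨ y ≔ a ⟩) (ρ [ y ≔ nothing ]ᶜ) x
    look-strong ρ h s y a x with does (y ≟ x)
    ... | true  = refl
    ... | false = refl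

    look-extends : ∀ {ρ n s h h′} → Below ρ n → (∀ {j} → j < n → h′ j ≡ h j) → ∀ x → look h s ρ x ≡ look h′ s ρ x
    look-extends {ρ} below eq x with ρ x in ρx
    ... | nothing = refl
    ... | just j  = sym (eq (below ρx))

    plan : ∀ {B φ} (k : Skeleton B φ) {ρ n s} h → Below ρ n → AllWeak ρ φ → Agree B s s₀ →
           Sat k (look h s ρ) → Plan k ρ n s s₀ h
    plan (pos a) {n = n} h below aw agree t = record
      { witness = h ; pairs = [] ; extends = λ _ → refl ; few = z≤n ; distinct = [] ; guard = tt
      ; realise = λ C f C⇔ _ → literal-witnessed (atom a) C f (λ eq → <-≤-trans (below eq) (m≤m+n n 1)) C⇔ t }
    plan (neg a _) {n = n} h below aw agree t = record
      { witness = h ; pairs = [] ; extends = λ _ → refl ; few = z≤n ; distinct = [] ; guard = tt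
      ; realise = λ C f C⇔ _ → literal-witnessed (¬ᶠ atom a) C f (λ eq → <-≤-trans (below eq) (m≤m+n n 1)) C⇔ t }
    -- The pair consists of the two values that are compared; an element common to both classes
    -- would give them the same value under `f`.
    plan (neq y z) {ρ} {n} {s} h below aw agree t = record
      { witness = h ; pairs = (look h s ρ y , look h s ρ z) ∷ [] ; extends = λ _ → refl
      ; few = ≤-refl ; distinct = t ∷ [] ; guard = tt
      ; realise = λ { C f C⇔ (≢ ∷ []) (u , p , q) →
          let fibre = possible-fibre {s = s} C f (λ eq → <-≤-trans (below eq) (m≤m+n n 1)) C⇔ in
          ≢ (trans (sym (fibre y p)) (fibre z q)) } }
    plan {φ = α ∧ᶠ β} (both k l) {ρ} {n} {s} h below aw agree (t , t′) = record
      { witness  = witness P₂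
      ; pairs    = pairs P₁ ++ pairs P₂
      ; extends  = λ j<n → trans (extends P₂ (m≤n⇒m≤n+o (size α) j<n)) (extends P₁ j<n)
      ; few      = ≤-trans (≤-reflexive (length-++ (pairs P₁))) (m≤n⇒m≤1+n (+-mono-≤ (few P₁) (few P₂)))
      ; distinct = All.++⁺ (distinct P₁) (distinct P₂)
      ; guard    = guard P₁ , guard P₂
      ; realise  = λ C f C⇔ sep →
          -- The classes are fibres over the final witnesses, which coincide with those of the first
          -- conjunct on all its colours.
          realise P₁ C f (λ {j} {u} j< → subst (λ v → C j u ⇔ f u ≡ f v) (extends P₂ j<)
            (C⇔ (<-≤-trans j< (+-monoʳ-≤ n (m≤n⇒m≤1+n (m≤m+n (size α) (size β)))))))
            (All.++⁻ˡ (pairs P₁) sep) ,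
          realise P₂ C f (λ {j} j< → C⇔ (<-≤-trans (subst (j <_) (+-assoc n (size α) (size β)) j<) (+-monoʳ-≤ n (n≤1+n _))))
            (All.++⁻ʳ (pairs P₁) sep)
      }
      where
      P₁ = plan k {ρ} {n} h below (λ eq → Weak-∧ˡ {α = α} {β} (aw eq)) agree t
      -- The second conjunct continues from the witnesses of the first. Variables coloured above it
      -- have colours below `n`, where these witnesses still agree with `h`.
      P₂ = plan l {ρ} {n + size α} (witness P₁) (λ eq → m≤n⇒m≤n+o (size α) (below eq))
             (λ eq → Weak-∧ʳ {α = α} {β} (aw eq)) agree
             (Sat-cong l (look-extends {ρ} {s = s} below (extends P₁)) t′)
    plan {φ = α ∨ᶠ β} (left k) {ρ} {n} h below aw agree t = record
      { witness = witness P ; pairs = pairs P ; extends = extends P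
      ; few = ≤-trans (few P) (m≤n⇒m≤1+n (m≤m+n (size α) (size β))) ; distinct = distinct P ; guard = guard P
      ; realise = λ C f C⇔ → realise P C f
          (λ j< → C⇔ (<-≤-trans j< (+-monoʳ-≤ n (m≤n⇒m≤1+n (m≤m+n (size α) (size β)))))) }
      where P = plan k {ρ} {n} h below (λ eq → Weak-∨ˡ {α = α} {β} (aw eq)) agree t
    plan {φ = α ∨ᶠ β} (right k) {ρ} {n} h below aw agree t = record
      { witness = witness P ; pairs = pairs P ; extends = extends P
      ; few = ≤-trans (few P) (m≤n⇒m≤1+n (m≤n+m (size β) (size α))) ; distinct = distinct P ; guard = guard P
      ; realise = λ C f C⇔ → realise P C f
          (λ j< → C⇔ (<-≤-trans j< (+-monoʳ-≤ n (m≤n⇒m≤1+n (m≤n+m (size β) (size α)))))) }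
      where P = plan k {ρ} {n} h below (λ eq → Weak-∨ʳ {α = α} {β} (aw eq)) agree t
    plan (weak y {φ} w k) {ρ} {n} {s} h below aw agree (a , t) = record
      { witness = witness P ; pairs = pairs P
      ; extends = λ j<n → trans (extends P (m<n⇒m<1+n j<n)) (upd-≢ h a (<⇒≢ j<n ∘ sym))
      ; few = m≤n⇒m≤1+n (few P) ; distinct = distinct P ; guard = guard P
      ; realise = λ C f C⇔ → realise P C f (λ {j} j< → C⇔ (subst (j <_) (sym (+-suc n (size φ))) j<)) }
      where
      P = plan k {ρ [ y ≔ just n ]ᶜ} {suc n} (h ⟨ n ≔ a ⟩)
            (colour-elim (λ _ j → j < suc n) ρ y (just n) (λ { refl → n<1+n n }) (λ _ eq → m<n⇒m<1+n (below eq)))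
            (colour-elim (λ x _ → Weak∃ x φ) ρ y (just n) (λ _ → w) (λ y≢x eq → Weak-∃ {ψ = φ} (y≢x ∘ sym) (aw eq)))
            agree (Sat-cong k (look-weak h s y a below) t)
    plan (strong y {φ} ¬w k) {ρ} {n} {s} h below aw agree (a , t) = record
      { witness = witness P ; pairs = pairs P ; extends = extends P
      ; few = m≤n⇒m≤1+n (few P) ; distinct = distinct P ; guard = guard P
      ; realise = λ C f C⇔ sep → a , realise P C f (λ j< → C⇔ (<-≤-trans j< (+-monoʳ-≤ n (n≤1+n (size φ))))) sep }
      where
      P = plan k {ρ [ y ≔ nothing ]ᶜ} {n} h
            (colour-elim (λ _ j → j < n) ρ y nothing (λ ()) (λ _ eq → below eq))
            (colour-elim (λ x _ → Weak∃ x φ) ρ y nothing (λ ()) (λ y≢x eq → Weak-∃ {ψ = φ} (y≢x ∘ sym) (aw eq)))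
            (Agree-upd a agree) (Sat-cong k (look-strong ρ h s y a) t)
    plan {φ = φ} (inner _ _) {ρ} {n} {s} h below aw agree t = record
      { witness = h ; pairs = [] ; extends = λ _ → refl ; few = z≤n ; distinct = [] ; guard = tt
      ; realise = λ _ _ _ _ → coincidence φ ordinary t }
      where
      ordinary : ∀ x → x ∈ free φ → look h s ρ x ≡ s x
      ordinary x x∈ with ρ x in ρx
      ... | nothing = refl
      ... | just _  = contradiction (inj₁ (here x∈)) (aw ρx)
    plan {B} {φ} (outer _ ¬i) {ρ} {n} {s} h below aw agree t = record
      { witness = h ; pairs = [] ; extends = λ _ → refl ; few = z≤n ; distinct = []
      ; guard = coincidence φ ordinary t ; realise = λ _ _ _ _ → tt }
      where
      ordinary : ∀ x → x ∈ free φ → look h s ρ x ≡ s₀ x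
      ordinary x x∈ with ρ x in ρx
      ... | nothing = agree λ x∈B → ¬i (lose x∈ x∈B)
      ... | just _  = contradiction (inj₁ (here x∈)) (aw ρx)

-- Definability with bounded resources

Property : Signature → Set₁
Property τ = (A : Structure τ) → Assignment A → Set

-- Rank and names are carried as upper bounds, so that each connective on properties updates
-- equivalence, rank and names together. `N` excludes structures too small for the arithmetic.
record Definable {τ} (N : ℕ) (P : Property τ) (d : ℕ) (V : Var → Set) : Set₁ where
  field
    formula  : Formula τ
    sound    : ∀ A s → N ≤ Structure.last A → (A ⊨ s) formula → P A s
    complete : ∀ A s → N ≤ Structure.last A → P A s → (A ⊨ s) formula
    qr≤      : qr formula ≤ d
    bound⊆   : ∀ {x} → x ∈ bound formula → V x

open Definable

module _ {τ : Signature} where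

  private variable
    N N′ d d′ : ℕ
    V V′ : Var → Set
    P Q : Property τ

  update : (A : Structure τ) → Assignment A → Var → Structure.Universe A → Assignment A
  update A s x a = Sem._⟨_≔_⟩ A s x a

  exact : ∀ (φ : Formula τ) → qr φ ≤ d → (∀ {x} → x ∈ bound φ → V x) → Definable N (λ A s → (A ⊨ s) φ) d V
  exact φ q b = record { formula = φ ; sound = λ _ _ _ h → h ; complete = λ _ _ _ h → h ; qr≤ = q ; bound⊆ = b }

  restate : (∀ A s → N ≤ Structure.last A → P A s → Q A s) → (∀ A s → N ≤ Structure.last A → Q A s → P A s) →
            Definable N P d V → Definable N Q d V
  restate f g D = record
    { formula = formula D ; sound = λ A s l h → f A s l (sound D A s l h)
    ; complete = λ A s l h → complete D A s l (g A s l h) ; qr≤ = qr≤ D ; bound⊆ = bound⊆ D }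

  weaken : N ≤ N′ → d ≤ d′ → (∀ {x} → V x → V′ x) → Definable N P d V → Definable N′ P d′ V′
  weaken N≤ d≤ V⊆ D = record
    { formula = formula D ; sound = λ A s l → sound D A s (≤-trans N≤ l)
    ; complete = λ A s l → complete D A s (≤-trans N≤ l) ; qr≤ = ≤-trans (qr≤ D) d≤ ; bound⊆ = V⊆ ∘ bound⊆ D }

  _∧ᵈ_ : Definable N P d V → Definable N Q d V → Definable N (λ A s → P A s × Q A s) d V
  D ∧ᵈ E = record
    { formula = formula D ∧ᶠ formula E
    ; sound = λ A s l → Product.map (sound D A s l) (sound E A s l)
    ; complete = λ A s l → Product.map (complete D A s l) (complete E A s l)
    ; qr≤ = ⊔-lub (qr≤ D) (qr≤ E)
    ; bound⊆ = [ bound⊆ D , bound⊆ E ]′ ∘ ∈-++⁻ (bound (formula D)) }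

  _∨ᵈ_ : Definable N P d V → Definable N Q d V → Definable N (λ A s → P A s ⊎ Q A s) d V
  D ∨ᵈ E = record
    { formula = formula D ∨ᶠ formula E
    ; sound = λ A s l → Sum.map (sound D A s l) (sound E A s l)
    ; complete = λ A s l → Sum.map (complete D A s l) (complete E A s l)
    ; qr≤ = ⊔-lub (qr≤ D) (qr≤ E)
    ; bound⊆ = [ bound⊆ D , bound⊆ E ]′ ∘ ∈-++⁻ (bound (formula D)) }

  ¬ᵈ_ : Definable N P d V → Definable N (λ A s → ¬ P A s) d V
  ¬ᵈ D = record
    { formula = ¬ᶠ formula D ; sound = λ A s l n → n ∘ complete D A s l
    ; complete = λ A s l n → n ∘ sound D A s l ; qr≤ = qr≤ D ; bound⊆ = bound⊆ D }

  ∃ᵈ : ∀ x → V x → Definable N P d V → Definable N (λ A s → ∃[ a ] P A (update A s x a)) (suc d) V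
  ∃ᵈ x Vx D = record
    { formula = ∃ᶠ x (formula D)
    ; sound = λ A s l (a , h) → a , sound D A _ l h
    ; complete = λ A s l (a , h) → a , complete D A _ l h
    ; qr≤ = s≤s (qr≤ D)
    ; bound⊆ = λ { (here refl) → Vx ; (there x∈) → bound⊆ D x∈ } }

  ⊤ᵈ : Definable N (λ _ _ → ⊤) d V
  ⊤ᵈ = restate (λ _ _ _ _ → tt) (λ _ _ _ _ → refl) (exact ⊤ᶠ z≤n λ ())

  ⋁ᵈ : ∀ {X : Set} {R : X → Property τ} → (∀ x → Definable N (R x) d V) → (xs : List X) →
       Definable N (λ A s → ∃[ x ] x ∈ xs × R x A s) d V
  ⋁ᵈ D []       = restate (λ _ _ _ n → contradiction refl n) (λ { _ _ _ (_ , () , _) }) (exact ⊥ᶠ z≤n λ ())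
  ⋁ᵈ D (x ∷ xs) = restate
    (λ { _ _ _ (inj₁ h) → x , here refl , h ; _ _ _ (inj₂ (y , y∈ , h)) → y , there y∈ , h })
    (λ { _ _ _ (_ , here refl , h) → inj₁ h ; _ _ _ (y , there y∈ , h) → inj₂ (y , y∈ , h) })
    (D x ∨ᵈ ⋁ᵈ D xs)

  ∀<ᵈ : ∀ {R : ℕ → Property τ} → (∀ j → Definable N (R j) d V) → ∀ k →
        Definable N (λ A s → ∀ {j} → j < k → R j A s) d V
  ∀<ᵈ D zero        = restate (λ _ _ _ _ ()) (λ _ _ _ _ → tt) ⊤ᵈ
  ∀<ᵈ {R = R} D (suc k) = restate join (λ A s _ h → h (n<1+n k) , λ j< → h (m<n⇒m<1+n j<)) (D k ∧ᵈ ∀<ᵈ D k)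
    where
    join : ∀ A s → _ → R k A s × (∀ {j} → j < k → R j A s) → ∀ {j} → j < suc k → R j A s
    join A s _ (h , i) {j} j<1+k with m≤n⇒m<n∨m≡n (≤-pred j<1+k)
    ... | inj₁ j<k  = i j<k
    ... | inj₂ refl = h

  -- x₂ is congruent modulo x₄ = 1 + μ x₁ to the residue x₇ of x₀ modulo x₆ = 1 + ν x₁.
  classFormula : ℕ → ℕ → Formula τ
  classFormula μ ν =
    ∃ᶠ 3 (atom (rel mult (numeral μ ∷ var 1 ∷ var 3 ∷ [])) ∧ᶠ
    ∃ᶠ 4 (atom (rel add (numeral 1 ∷ var 3 ∷ var 4 ∷ [])) ∧ᶠ
    ∃ᶠ 5 (atom (rel mult (numeral ν ∷ var 1 ∷ var 5 ∷ [])) ∧ᶠ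
    ∃ᶠ 6 (atom (rel add (numeral 1 ∷ var 5 ∷ var 6 ∷ [])) ∧ᶠ
    ∃ᶠ 7 (atom (rel lt (var 7 ∷ var 4 ∷ [])) ∧ᶠ
      ∃ᶠ 8 (∃ᶠ 9 (atom (rel mult (var 8 ∷ var 4 ∷ var 9 ∷ [])) ∧ᶠ atom (rel add (var 9 ∷ var 7 ∷ var 2 ∷ [])))) ∧ᶠ
      ∃ᶠ 8 (∃ᶠ 9 (atom (rel mult (var 8 ∷ var 6 ∷ var 9 ∷ [])) ∧ᶠ atom (rel add (var 9 ∷ var 7 ∷ var 0 ∷ [])))))))))

  -- Arithmetic meaning of the class formula

  module _ (A : Structure τ) where
    open Structure A
    open Sem A

    HasRemainder : Universe → Universe → Universe → Set
    HasRemainder u p r = ∃[ q ] ∃[ v ] rank q * rank p ≡ rank v × rank v + rank r ≡ rank u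

    -- `add` and `mult` can hold only if the result is an element, so every intermediate value is
    -- quantified as an element.
    Class : ℕ → ℕ → Universe → Universe → Universe → Set
    Class μ ν a b u =
      ∃[ t ] rank (element μ) * rank b ≡ rank t × ∃[ p ] rank (element 1) + rank t ≡ rank p ×
      ∃[ t′ ] rank (element ν) * rank b ≡ rank t′ × ∃[ m ] rank (element 1) + rank t′ ≡ rank m ×
      ∃[ r ] rank r < rank p × HasRemainder u p r × HasRemainder a m r

    classFormula-sound : ∀ μ ν {e} → e ⊩ classFormula μ ν → Class μ ν (e 0) (e 1) (e 2)
    classFormula-sound μ ν {e} (t , t≡ , p , p≡ , t′ , t′≡ , h) =
      t , subst (λ u → rank u * rank (e 1) ≡ rank t) (⟦numeral⟧ μ _) t≡ , p , p≡ ,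
      t′ , subst (λ u → rank u * rank (e 1) ≡ rank t′) (⟦numeral⟧ ν _) t′≡ , h

    classFormula-complete : ∀ μ ν {e} → Class μ ν (e 0) (e 1) (e 2) → e ⊩ classFormula μ ν
    classFormula-complete μ ν {e} (t , t≡ , p , p≡ , t′ , t′≡ , h) =
      t , subst (λ u → rank u * rank (e 1) ≡ rank t) (sym (⟦numeral⟧ μ _)) t≡ , p , p≡ ,
      t′ , subst (λ u → rank u * rank (e 1) ≡ rank t′) (sym (⟦numeral⟧ ν _)) t′≡ , h

    hasRemainder : ∀ {u p r k} .{{_ : NonZero k}} → rank p ≡ k → rank r < k → HasRemainder u p r → rank u % k ≡ rank r
    hasRemainder {u} {p} {r} {k} refl r< (q , v , v≡ , u≡) = trans
      (cong (_% k) (trans (sym u≡) (trans (cong (_+ rank r) (sym v≡)) (+-comm (rank q * k) (rank r)))))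
      (trans ([m+kn]%n≡m%n (rank r) (rank q) k) (m<n⇒m%n≡m r<))

    hasRemainder⁻¹ : ∀ {u p r k} .{{_ : NonZero k}} → rank p ≡ k → rank u % k ≡ rank r → HasRemainder u p r
    hasRemainder⁻¹ {u} {p} {r} {k} refl r≡ =
      element q , element (q * k) ,
      trans (cong (_* k) (rank-element-≤ (≤-trans (m/n≤m (rank u) k) (rank≤last u)))) (sym v≡) ,
      trans (cong₂ _+_ v≡ (sym r≡)) (trans (+-comm (q * k) _) (sym (m≡m%n+[m/n]*n (rank u) k)))
      where
      q = rank u / k
      v≡ : rank (element (q * k)) ≡ q * k
      v≡ = rank-element-≤ (≤-trans (m/n*n≤m (rank u) k) (rank≤last u))

    module _ {i i′ : ℕ} {a b : Universe} (b≥1 : 1 ≤ rank b) (i≤i′ : i ≤ i′)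
             (bounded : modulus (rank b) i′ ≤ last) where

      private
        suc≤last : ∀ {j} → j ≤ i′ → modulus (rank b) j ≤ last
        suc≤last j≤ = ≤-trans (s≤s (*-monoˡ-≤ (rank b) (s≤s j≤))) bounded

        -- A numeral denotes its value only up to `last`; by `b≥1` the number `suc j` is below
        -- `modulus (rank b) j`.
        index≤last : ∀ {j} → j ≤ i′ → suc j ≤ last
        index≤last {j} j≤ = ≤-trans (≤-reflexive (sym (*-identityʳ (suc j))))
          (≤-trans (*-monoʳ-≤ (suc j) b≥1) (≤-trans (n≤1+n _) (suc≤last j≤)))

        rank-1 : rank (element 1) ≡ 1
        rank-1 = rank-element-≤ (≤-trans (s≤s z≤n) (index≤last i≤i′))

        rank-modulus : ∀ {j} → j ≤ i′ → ∀ {t p} → rank (element (suc j)) * rank b ≡ rank t →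
                       rank (element 1) + rank t ≡ rank p → rank p ≡ modulus (rank b) j
        rank-modulus {j} j≤ t≡ p≡ = trans (sym p≡) (cong₂ _+_ rank-1
          (trans (sym t≡) (cong (_* rank b) (rank-element-≤ (index≤last j≤)))))

        modulus-element : ∀ {j} → j ≤ i′ → ∃[ t ] rank (element (suc j)) * rank b ≡ rank t ×
                          ∃[ p ] rank (element 1) + rank t ≡ rank p
        modulus-element {j} j≤ = element (suc j * rank b) , trans (cong (_* rank b) (rank-element-≤ (index≤last j≤))) (sym t≡) ,
          element (modulus (rank b) j) , trans (cong₂ _+_ rank-1 t≡) (sym (rank-element-≤ (suc≤last j≤)))
          where
          t≡ : rank (element (suc j * rank b)) ≡ suc j * rank b
          t≡ = rank-element-≤ (≤-trans (n≤1+n _) (suc≤last j≤))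

      -- The bound on the larger modulus makes all intermediate values available as elements. Since
      -- `i ≤ i′`, a remainder for the smaller modulus is also below the larger one, so it can be
      -- compared with the remainder of `a`, which codes that of `v`.
      Class-fibre : ∀ {v} → rank a % modulus (rank b) i′ ≡ v % modulus (rank b) i →
                    ∀ u → Class (suc i) (suc i′) a b u ⇔ rank u % modulus (rank b) i ≡ v % modulus (rank b) i
      Class-fibre {v} a≡ u = mk⇔
        (λ (t , t≡ , p , p≡ , t′ , t′≡ , m , m≡ , r , r<p , hu , ha) →
          let p≡′ = rank-modulus i≤i′ {t} {p} t≡ p≡
              m≡′ = rank-modulus ≤-refl {t′} {m} t′≡ m≡
              r<  = subst (rank r <_) p≡′ r<p
          in trans (hasRemainder {u} {p} {r} p≡′ r< hu)
               (trans (sym (hasRemainder {a} {m} {r} m≡′ (<-≤-trans r< (s≤s (*-monoˡ-≤ (rank b) (s≤s i≤i′)))) ha)) a≡))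
        (λ eq →
          let t , t≡ , p , p≡     = modulus-element i≤i′
              t′ , t′≡ , m , m≡   = modulus-element {i′} ≤-refl
              p≡′ = rank-modulus i≤i′ {t} {p} t≡ p≡
              m≡′ = rank-modulus ≤-refl {t′} {m} t′≡ m≡
              r≡ = rank-element-≤ (≤-trans (m%n≤m (rank u) (modulus (rank b) i)) (rank≤last u))
          in t , t≡ , p , p≡ , t′ , t′≡ , m , m≡ , element (rank u % modulus (rank b) i) ,
             subst₂ _<_ (sym r≡) (sym p≡′) (m%n<n (rank u) (modulus (rank b) i)) ,
             hasRemainder⁻¹ p≡′ (sym r≡) , hasRemainder⁻¹ m≡′ (trans a≡ (trans (sym eq) (sym r≡))))

-- Bounds for literals; strong rank and strong names at a quantifier

module _ {τ : Signature} where

  3≤arity : 3 ≤ arity τ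
  3≤arity = ⊥≤max 3 (relArities τ)

  symbol-arity : ∀ {k} → RelSym τ k → k ≤ arity τ
  symbol-arity lt        = ≤-trans (n≤1+n 2) 3≤arity
  symbol-arity add       = 3≤arity
  symbol-arity mult      = 3≤arity
  symbol-arity (other i) = All.lookup (xs≤max 3 (relArities τ)) (∈-lookup i)

  length-termVars : ∀ (t : Term τ) → length (termVars t) ≤ 1
  length-termVars (var x)   = ≤-refl
  length-termVars (const c) = z≤n
  length-termVars (succ t)  = length-termVars t

  length-atomVars : ∀ (a : Atom τ) → length (atomVars a) ≤ arity τ
  length-atomVars (rel {k} R ts) = ≤-trans (go ts) (symbol-arity R)
    where
    go : ∀ {k} (ts : Vec (Term τ) k) → length (Vec.foldr _ (λ t xs → termVars t ++ xs) [] ts) ≤ k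
    go []       = z≤n
    go (t ∷ ts) = ≤-trans (≤-reflexive (length-++ (termVars t))) (+-mono-≤ (length-termVars t) (go ts))
  length-atomVars (t ≐ u) = ≤-trans (≤-reflexive (length-++ (termVars t)))
    (≤-trans (+-mono-≤ (length-termVars t) (length-termVars u)) (≤-trans (n≤1+n 2) 3≤arity))

  strong-qr-weak : ∀ {x} {φ : Formula τ} → Weak∃ x φ → strong-qr (∃ᶠ x φ) ≡ strong-qr φ
  strong-qr-weak {x} {φ} w = cong (if_then strong-qr φ else suc (strong-qr φ)) (dec-true (weak∃? x φ) w)

  strong-qr-strong : ∀ {x} {φ : Formula τ} → ¬ Weak∃ x φ → strong-qr (∃ᶠ x φ) ≡ suc (strong-qr φ)
  strong-qr-strong {x} {φ} ¬w = cong (if_then strong-qr φ else suc (strong-qr φ)) (dec-false (weak∃? x φ) ¬w)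

  strong-bound-weak : ∀ {x} {φ : Formula τ} → Weak∃ x φ → strong-bound (∃ᶠ x φ) ≡ strong-bound φ
  strong-bound-weak {x} {φ} w = cong (if_then strong-bound φ else x ∷ strong-bound φ) (dec-true (weak∃? x φ) w)

  strong-bound-strong : ∀ {x} {φ : Formula τ} → ¬ Weak∃ x φ → strong-bound (∃ᶠ x φ) ≡ x ∷ strong-bound φ
  strong-bound-strong {x} {φ} ¬w = cong (if_then strong-bound φ else x ∷ strong-bound φ) (dec-false (weak∃? x φ) ¬w)

module _ {τ : Signature} (A : Structure τ) where
  open Structure A
  open Sem A
  open Blocks A

  -- This and `Coloured-cong` serve to overwrite the names of the parameters, which do not occur in
  -- `φ`.
  Guard-cong : ∀ {B φ} (k : Skeleton B φ) {s s′} → (∀ x → x ∈ vars φ → s x ≡ s′ x) → Guard k s → Guard k s′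
  Guard-cong (pos _)        eq g = tt
  Guard-cong (neg _ _)      eq g = tt
  Guard-cong (neq _ _)      eq g = tt
  Guard-cong {φ = α ∧ᶠ β} (both k l) eq (g , g′) =
    Guard-cong k (λ x x∈ → eq x (∈-++⁺ˡ x∈)) g , Guard-cong l (λ x x∈ → eq x (∈-++⁺ʳ (vars α) x∈)) g′
  Guard-cong (left k)       eq g = Guard-cong k (λ x x∈ → eq x (∈-++⁺ˡ x∈)) g
  Guard-cong {φ = α ∨ᶠ β} (right k) eq g = Guard-cong k (λ x x∈ → eq x (∈-++⁺ʳ (vars α) x∈)) g
  Guard-cong (weak _ _ k)   eq g = Guard-cong k (λ x x∈ → eq x (there x∈)) g
  Guard-cong (strong _ _ k) eq g = Guard-cong k (λ x x∈ → eq x (there x∈)) g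
  Guard-cong (inner _ _)    eq g = tt
  Guard-cong {φ = φ} (outer _ _) eq g = coincidence φ (λ x x∈ → eq x (free⊆vars φ x∈)) g

  Coloured-cong : ∀ {B φ} (k : Skeleton B φ) {C ρ n s s′} → (∀ x → x ∈ vars φ → s x ≡ s′ x) →
                  Coloured k C ρ n s → Coloured k C ρ n s′
  Coloured-cong (pos _)   {C} {ρ} eq (m , fits , h) = m , (λ x x∈ → subst (λ c → Possible C (ρ x) c (m x)) (eq x x∈) (fits x x∈)) , h
  Coloured-cong (neg _ _) {C} {ρ} eq (m , fits , h) = m , (λ x x∈ → subst (λ c → Possible C (ρ x) c (m x)) (eq x x∈) (fits x x∈)) , h
  Coloured-cong (neq y z) {C} {ρ} eq t (u , p , q) =
    t (u , subst (λ c → Possible C (ρ y) c u) (sym (eq y (here refl))) p ,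
           subst (λ c → Possible C (ρ z) c u) (sym (eq z (there (here refl)))) q)
  Coloured-cong {φ = α ∧ᶠ β} (both k l) eq (t , t′) =
    Coloured-cong k (λ x x∈ → eq x (∈-++⁺ˡ x∈)) t , Coloured-cong l (λ x x∈ → eq x (∈-++⁺ʳ (vars α) x∈)) t′
  Coloured-cong (left k)     eq t = Coloured-cong k (λ x x∈ → eq x (∈-++⁺ˡ x∈)) t
  Coloured-cong {φ = α ∨ᶠ β} (right k) eq t = Coloured-cong k (λ x x∈ → eq x (∈-++⁺ʳ (vars α) x∈)) t
  Coloured-cong (weak _ _ k) eq t = Coloured-cong k (λ x x∈ → eq x (there x∈)) t
  Coloured-cong (strong y _ k) {s = s} {s′} eq (a , t) =
    a , Coloured-cong k (λ x x∈ → upd-cong s s′ y a x λ _ → eq x (there x∈)) t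
  Coloured-cong {φ = φ} (inner _ _) eq t = coincidence φ (λ x x∈ → eq x (free⊆vars φ x∈)) t
  Coloured-cong (outer _ _)  eq t = tt

  Possible-cong : ∀ μ (ν : ℕ → ℕ) r {a a′ b b′ c c′ u u′ : Universe} → a ≡ a′ → b ≡ b′ → c ≡ c′ → u ≡ u′ →
    Possible (λ j → Class A μ (ν j) a b) r c u → Possible (λ j → Class A μ (ν j) a′ b′) r c′ u′
  Possible-cong _ _ _ refl refl refl refl p = p

  -- The position of a separating modulus is a constant; only its parameters a and b depend on the structure.
  classes-exist : ∀ {K M} (h : ℕ → Universe) (D : List (Universe × Universe)) →
    Hashing K M last (rank ∘ h) (mapˡ (Product.map rank rank) D) →
    ∃[ i ] i < M × ∃[ a ] ∃[ b ] ∃[ f ]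
      (∀ {j u} → j < K → Class A (suc i) (suc (M + j)) a b u ⇔ f u ≡ f (h j)) ×
      All (λ p → f (proj₁ p) ≢ f (proj₂ p)) D
  classes-exist {K} {M} h D H =
    i , i<M , element a , element b , (λ u → rank u % modulus (rank (element b)) i) ,
    (λ {j} {u} j<K → Class-fibre A {a = element a} {element b}
      (subst (1 ≤_) (sym rank-b) b≥1) (≤-trans (<⇒≤ i<M) (m≤m+n M j))
      (subst (λ b → modulus b (M + j) ≤ last) (sym rank-b) (bounded (M + j) (+-monoʳ-< M j<K)))
      {rank (h j)}
      (subst₂ (λ a b → a % modulus b (M + j) ≡ rank (h j) % modulus b i) (sym (rank-element-≤ a≤last)) (sym rank-b) (residue j j<K)) u) ,
    subst (λ b → All (λ p → rank (proj₁ p) % modulus b i ≢ rank (proj₂ p) % modulus b i) D) (sym rank-b) (All.map⁻ separated)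
    where
    open Hashing H
    rank-b : rank (element b) ≡ b
    rank-b = rank-element-≤ (≤-trans (≤-trans (m≤m+n b (i * b)) (n≤1+n _)) (bounded i (≤-trans i<M (m≤m+n M K))))

-- Elimination of the weak quantifiers of a block

module Elimination {τ : Signature} (F : ℕ) where

  -- Membership in a class takes 8 quantifiers, 7 in `classFormula` and one for a copy of the
  -- element. A literal adds at most `arity τ`, one for each variable occurrence; nonemptiness and
  -- disjointness of classes add one.
  base : ℕ
  base = arity τ + 9

  -- The variable k + F is used as follows: k = 0, 1 are the parameters a, b of the classes,
  -- 2 ≤ k ≤ 9 are local to classFormula, and 10 ≤ k stand for the variables of a literal.
  InPool : Var → Set
  InPool x = F ≤ x × x < 10 + arity τ + F

  Names : List Var → Var → Set
  Names xs x = x ∈ xs ⊎ InPool x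

  private variable
    N : ℕ
    xs ys : List Var

  pool : ∀ k → k < 10 + arity τ → Names xs (k + F)
  pool k k< = inj₂ (m≤n+m F k , +-monoˡ-< F k<)

  pool-10 : ∀ k → k < 10 → Names xs (k + F)
  pool-10 k k< = pool k (≤-trans k< (m≤m+n 10 (arity τ)))

  names-mono : (∀ {x} → x ∈ xs → x ∈ ys) → ∀ {x} → Names xs x → Names ys x
  names-mono f = Sum.map₁ f

  fresh : ℕ → Var
  fresh k = 10 + k + F

  fresh-pool : ∀ k → k < arity τ → Names xs (fresh k)
  fresh-pool k k< = pool (10 + k) (+-monoʳ-< 10 k<)

  0<arity : 0 < arity τ
  0<arity = ≤-trans (s≤s z≤n) (3≤arity {τ})

  +F-≢ : ∀ {j k} → j ≢ k → j + F ≢ k + F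
  +F-≢ {j} {k} j≢k eq = j≢k (+-cancelʳ-≡ F j k eq)

  old-≢ : ∀ {x} k → x < F → k + F ≢ x
  old-≢ k x<F refl = <⇒≱ x<F (m≤n+m F k)

  data Literal : Formula τ → Set where
    pos : ∀ a → Literal (atom a)
    neg : ∀ a → Literal (¬ᶠ atom a)

  substˡ : ∀ {ℓ} → (Var → Var) → Literal ℓ → Formula τ
  substˡ σ (pos a) = atom (substᵃ (var ∘ σ) a)
  substˡ σ (neg a) = ¬ᶠ atom (substᵃ (var ∘ σ) a)

  substˡᵈ : ∀ {ℓ} (L : Literal ℓ) σ {d} → Definable N (λ A s → (A ⊨ (s ∘ σ)) ℓ) d (Names xs)
  substˡᵈ (pos a) σ = restate (λ A s _ → subst id (Sem.Holds-subst A (var ∘ σ) a s))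
    (λ A s _ → subst id (sym (Sem.Holds-subst A (var ∘ σ) a s))) (exact (substˡ σ (pos a)) z≤n λ ())
  substˡᵈ (neg a) σ = restate (λ A s _ n → n ∘ subst id (sym (Sem.Holds-subst A (var ∘ σ) a s)))
    (λ A s _ n → n ∘ subst id (Sem.Holds-subst A (var ∘ σ) a s)) (exact (substˡ σ (neg a)) z≤n λ ())

  -- The parameters a and b of the classes cost two quantifiers, which are charged to the first strong
  -- quantifier of the block.
  charge : List Var → ℕ
  charge []      = 0
  charge (_ ∷ _) = 2

  depth : List Var → ℕ → ℕ
  depth B σ = charge B + base + 3 * σ

  depth-mono : ∀ B {m n} → m ≤ n → depth B m ≤ depth B n
  depth-mono B m≤n = +-monoʳ-≤ (charge B + base) (*-monoʳ-≤ 3 m≤n)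

  depth-strong : ∀ x B n → suc (depth (x ∷ B) n) ≤ depth B (suc n)
  depth-strong x B n = ≤-trans (≤-reflexive (shift base n)) (+-monoˡ-≤ (3 * suc n) (m≤n+m base (charge B)))
    where
    shift : ∀ b n → suc (2 + b + 3 * n) ≡ b + 3 * suc n
    shift = solve-∀

  base≤depth : ∀ B n → base ≤ depth B n
  base≤depth B n = ≤-trans (m≤n+m base (charge B)) (m≤m+n _ (3 * n))

  full : ℕ → ℕ
  full σ = 2 + base + 3 * σ

  Elim : Formula τ → Set₁
  Elim φ = Definable 0 (λ A s → (A ⊨ s) φ) (full (strong-qr φ)) (Names (strong-bound φ))

  -- The induction hypothesis for the outermost universal subformulas, arranged along the formula so
  -- that a recursion over skeletons meets it at its leaves.
  Universals : Formula τ → Set₁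
  Universals (atom a)     = Polymorphic.⊤
  Universals (¬ᶠ φ)       = Polymorphic.⊤
  Universals (φ ∧ᶠ ψ)     = Universals φ × Universals ψ
  Universals (φ ∨ᶠ ψ)     = Universals φ × Universals ψ
  Universals (∃ᶠ x φ)     = Universals φ
  Universals φ@(∀ᶠ _ _)   = Elim φ

  Bounded : Formula τ → Set
  Bounded φ = All (_< F) (vars φ)

  module Colour (M i : ℕ) where

    classes : (A : Structure τ) → Assignment A → ℕ → Structure.Universe A → Set
    classes A s j = Class A (suc i) (suc (M + j)) (s F) (s (suc F))

    -- The shifted `classFormula` reads its element at `2 + F`, so the value of `k + F` is copied
    -- there; `k ≢ 2` keeps the copying equation from being trivial.
    possibleᵈ : ∀ r y k → k ≢ 2 →
      Definable N (λ A s → Blocks.Possible A (classes A s) r (s y) (s (k + F))) 8 (Names xs)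
    possibleᵈ nothing  y k k≢2 = exact (atom (var (k + F) ≐ var y)) z≤n λ ()
    possibleᵈ {N} {xs} (just j) y k k≢2 = restate
      (λ A s _ (c , eq , h) → let open Sem A in
        subst (Class A μ ν (s F) (s (suc F)))
          (trans (sym (upd-≡ s (2 + F) c)) (trans eq (upd-≢ s c (+F-≢ (k≢2 ∘ sym)))))
          (subst (λ u → Class A μ ν (s F) (s (suc F)) u) (upd-≡ s (2 + F) c)
            (subst₂ (λ a b → Class A μ ν a b ((s ⟨ 2 + F ≔ c ⟩) (2 + F)))
              (upd-≢ s c (+F-≢ {2} {0} λ ())) (upd-≢ s c (+F-≢ {2} {1} λ ()))
              (classFormula-sound A μ ν (rename-sound (+-cancelʳ-≡ F _ _) χ h)))))
      (λ A s _ h → let open Sem A ; c = s (k + F) in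
        c , trans (upd-≡ s (2 + F) c) (sym (upd-≢ s c (+F-≢ (k≢2 ∘ sym)))) ,
        rename-complete (+-cancelʳ-≡ F _ _) χ (classFormula-complete A μ ν
          (subst₂ (λ a b → Class A μ ν a b ((s ⟨ 2 + F ≔ c ⟩) (2 + F)))
              (sym (upd-≢ s c (+F-≢ {2} {0} λ ()))) (sym (upd-≢ s c (+F-≢ {2} {1} λ ())))
            (subst (Class A μ ν (s F) (s (suc F))) (sym (upd-≡ s (2 + F) c)) h))))
      (∃ᵈ (2 + F) (pool-10 2 (s≤s (s≤s (s≤s z≤n))))
        (exact (atom (var (2 + F) ≐ var (k + F))) z≤n (λ ()) ∧ᵈ
         exact (rename (_+ F) χ) (≤-reflexive (qr-rename (_+ F) χ)) bound-class))
      where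
      μ ν : ℕ
      μ = suc i
      ν = suc (M + j)
      χ : Formula τ
      χ = classFormula μ ν
      bound-class : ∀ {x} → x ∈ bound (rename (_+ F) χ) → Names xs x
      bound-class {x} x∈ =
        let k , k∈ , eq = ∈-map⁻ (_+ F) (subst (x ∈_) (bound-rename (_+ F) χ) x∈)
        in subst (Names xs) (sym eq)
             -- `bound χ` does not mention `μ` and `ν`, so the comparison with 10 is decided by
             -- evaluation.
             (pool-10 k (All.lookup (toWitness {a? = All.all? (_<? 10) (bound χ)} tt) k∈))

    nonemptyᵈ : ∀ j → Definable N (λ A s → ∃[ u ] classes A s j u) 9 (Names xs)
    nonemptyᵈ j = restate
      (λ A s _ (u , p) → u , subst id (same A s u) p) (λ A s _ (u , p) → u , subst id (sym (same A s u)) p)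
      (∃ᵈ (fresh 0) (fresh-pool 0 0<arity) (possibleᵈ (just j) 0 10 λ ()))
      where
      same : ∀ A s u → classes A (update A s (fresh 0) u) j (update A s (fresh 0) u (fresh 0)) ≡ classes A s j u
      same A s u = let open Sem A in
        trans (cong (classes A (s ⟨ fresh 0 ≔ u ⟩) j) (upd-≡ s (fresh 0) u))
          (cong₂ (λ a b → Class A (suc i) (suc (M + j)) a b u)
            (upd-≢ s u (+F-≢ {10} {0} λ ())) (upd-≢ s u (+F-≢ {10} {1} λ ())))

    transport : ∀ A (s s′ : Assignment A) r {c c′ u u′} → s F ≡ s′ F → s (suc F) ≡ s′ (suc F) → c ≡ c′ → u ≡ u′ →
      Blocks.Possible A (classes A s) r c u → Blocks.Possible A (classes A s′) r c′ u′
    transport A s s′ r = Possible-cong A (suc i) (λ j → suc (M + j)) r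

    -- A stage between `Witnessed` and a mere substitution: the values of `vs` are still to be
    -- chosen, and any other variable `y` of the literal already has its value held by `σ y`.
    PartlyWitnessed : Colouring → Formula τ → List Var → (Var → Var) → Property τ
    PartlyWitnessed ρ ℓ vs σ A s =
      ∃[ m ] (∀ y → y ∈ vs → Blocks.Possible A (classes A s) (ρ y) (s y) (m y)) ×
             (∀ y → y ∈ free ℓ → y ∉ vs → m y ≡ s (σ y)) × (A ⊨ m) ℓ

    _[_≔_]ᵛ : (Var → Var) → Var → Var → Var → Var
    (σ [ y ≔ w ]ᵛ) z = if does (y ≟ z) then w else σ z

    -- A literal needs all its values at once, so each choice gets a new name; the bound on `σ y`
    -- says that later choices do not overwrite earlier ones.
    partlyWitnessedᵈ : ∀ {ℓ} (L : Literal ℓ) ρ → (∀ {y} → y ∈ free ℓ → y < F) → ∀ vs k σ →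
      (∀ {y} → y ∈ vs → y ∈ free ℓ) → (∀ {y} → y ∈ free ℓ → σ y < fresh k) → k + length vs ≤ arity τ →
      Definable N (PartlyWitnessed ρ ℓ vs σ) (length vs + 8) (Names xs)
    partlyWitnessedᵈ {ℓ = ℓ} L ρ <F [] k σ vs⊆ σ< k≤ = restate
      (λ A s _ h → (s ∘ σ) , (λ _ ()) , (λ _ _ _ → refl) , h)
      (λ A s _ (m , _ , m≡ , h) → Sem.coincidence A ℓ (λ x x∈ → m≡ x x∈ λ ()) h)
      (substˡᵈ L σ)
    partlyWitnessedᵈ {N} {xs} {ℓ} L ρ <F (y ∷ vs) k σ vs⊆ σ< k≤ = restate forth back
      (∃ᵈ (fresh k) (fresh-pool k k<)
        (weaken ≤-refl (m≤n+m 8 (length vs)) id (possibleᵈ (ρ y) y (10 + k) λ ()) ∧ᵈ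
         partlyWitnessedᵈ L ρ <F vs (suc k) σ′ (vs⊆ ∘ there) σ′< (subst (_≤ arity τ) (+-suc k (length vs)) k≤)))
      where
      k< : k < arity τ
      k< = <-≤-trans (m<m+n k (s≤s z≤n)) k≤
      w : Var
      w = fresh k
      σ′ : Var → Var
      σ′ = σ [ y ≔ w ]ᵛ
      σ′< : ∀ {z} → z ∈ free ℓ → σ′ z < fresh (suc k)
      σ′< {z} z∈ with does (y ≟ z)
      ... | true  = ≤-refl
      ... | false = m<n⇒m<1+n (σ< z∈)
      σ′-≡ : σ′ y ≡ w
      σ′-≡ = cong (if_then w else σ y) (dec-true (y ≟ y) refl)
      σ′-≢ : ∀ {z} → y ≢ z → σ′ z ≡ σ z
      σ′-≢ {z} y≢z = cong (if_then w else σ z) (dec-false (y ≟ z) y≢z)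
      module _ (A : Structure τ) (s : Assignment A) (c : Structure.Universe A) where
        open Sem A
        s′ : Assignment A
        s′ = s ⟨ w ≔ c ⟩
        s′-F : s′ F ≡ s F
        s′-F = upd-≢ s c (+F-≢ {10 + k} {0} λ ())
        s′-sucF : s′ (suc F) ≡ s (suc F)
        s′-sucF = upd-≢ s c (+F-≢ {10 + k} {1} λ ())
        s′-old : ∀ {z} → z ∈ free ℓ → s′ z ≡ s z
        s′-old z∈ = upd-≢ s c (old-≢ (10 + k) (<F z∈))
        s′-σ : ∀ {z} → z ∈ free ℓ → s′ (σ z) ≡ s (σ z)
        s′-σ z∈ = upd-≢ s c (<⇒≢ (σ< z∈) ∘ sym)
        s′-w : s′ w ≡ c
        s′-w = upd-≡ s w c
      y∈ : y ∈ free ℓ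
      y∈ = vs⊆ (here refl)
      forth : ∀ A s → N ≤ Structure.last A →
        (∃[ c ] Blocks.Possible A (classes A (s′ A s c)) (ρ y) (s′ A s c y) (s′ A s c w) × PartlyWitnessed ρ ℓ vs σ′ A (s′ A s c)) →
        PartlyWitnessed ρ ℓ (y ∷ vs) σ A s
      forth A s _ (c , p , m , fits , m≡ , h) = m , fits′ , m≡′ , h
        where
        fits′ : ∀ z → z ∈ y ∷ vs → Blocks.Possible A (classes A s) (ρ z) (s z) (m z)
        -- A name can be listed repeatedly; the value in `m` is the one chosen last.
        fits′ z z∈ with z ∈? vs
        ... | yes z∈vs = transport A (s′ A s c) s (ρ z) (s′-F A s c) (s′-sucF A s c) (s′-old A s c (vs⊆ (there z∈vs))) refl (fits z z∈vs)
        fits′ z (here refl) | no z∉vs = transport A (s′ A s c) s (ρ z) (s′-F A s c) (s′-sucF A s c) (s′-old A s c y∈)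
          (sym (trans (m≡ z y∈ z∉vs) (cong (s′ A s c) σ′-≡))) p
        fits′ z (there z∈)  | no z∉vs = contradiction z∈ z∉vs
        m≡′ : ∀ z → z ∈ free ℓ → z ∉ y ∷ vs → m z ≡ s (σ z)
        m≡′ z z∈ z∉ = trans (m≡ z z∈ (z∉ ∘ there))
          (trans (cong (s′ A s c) (σ′-≢ (λ y≡z → z∉ (here (sym y≡z))))) (s′-σ A s c z∈))
      back : ∀ A s → N ≤ Structure.last A → PartlyWitnessed ρ ℓ (y ∷ vs) σ A s →
        ∃[ c ] Blocks.Possible A (classes A (s′ A s c)) (ρ y) (s′ A s c y) (s′ A s c w) × PartlyWitnessed ρ ℓ vs σ′ A (s′ A s c)
      back A s _ (m , fits , m≡ , h) = c ,
        transport A s (s′ A s c) (ρ y) (sym (s′-F A s c)) (sym (s′-sucF A s c)) (sym (s′-old A s c y∈)) (sym (s′-w A s c)) (fits y (here refl)) ,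
        m , (λ z z∈ → transport A s (s′ A s c) (ρ z) (sym (s′-F A s c)) (sym (s′-sucF A s c)) (sym (s′-old A s c (vs⊆ (there z∈)))) refl (fits z (there z∈))) ,
        m≡′ , h
        where
        c = m y
        m≡′ : ∀ z → z ∈ free ℓ → z ∉ vs → m z ≡ s′ A s c (σ′ z)
        m≡′ z z∈ z∉ with y ≟ z
        ... | yes refl = sym (trans (cong (s′ A s c) σ′-≡) (s′-w A s c))
        ... | no y≢z   = trans (m≡ z z∈ (λ { (here z≡y) → y≢z (sym z≡y) ; (there z∈vs) → z∉ z∈vs }))
          (sym (trans (cong (s′ A s c) (σ′-≢ y≢z)) (s′-σ A s c z∈)))

    witnessedᵈ : ∀ {ℓ} → Literal ℓ → ∀ ρ → (∀ {y} → y ∈ free ℓ → y < F) →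
      Definable N (λ A s → Blocks.Witnessed A (classes A s) ρ s (free ℓ) ℓ) base (Names xs)
    witnessedᵈ {ℓ = ℓ} L ρ <F = restate
      (λ A s _ (m , fits , _ , h) → m , fits , h)
      (λ A s _ (m , fits , h) → m , fits , (λ x x∈ x∉ → contradiction x∈ x∉) , h)
      (weaken ≤-refl (+-mono-≤ (few L) (n≤1+n 8)) id
        (partlyWitnessedᵈ L ρ <F (free ℓ) 0 id id (λ y∈ → ≤-trans (<F y∈) (m≤n+m F 10)) (few L)))
      where
      few : ∀ {ℓ} → Literal ℓ → length (free ℓ) ≤ arity τ
      few (pos a) = length-atomVars a
      few (neg a) = length-atomVars a

    apartᵈ : ∀ (ρ : Colouring) y z → y < F → z < F →
      Definable N (λ A s → ¬ (∃[ u ] Blocks.Possible A (classes A s) (ρ y) (s y) u × Blocks.Possible A (classes A s) (ρ z) (s z) u))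
        base (Names xs)
    apartᵈ ρ y z y<F z<F = weaken ≤-refl (m≤n+m 9 (arity τ)) id (¬ᵈ (restate
      (λ A s _ (u , p , q) → u , to′ A s u (ρ y) y<F p , to′ A s u (ρ z) z<F q)
      (λ A s _ (u , p , q) → u , from′ A s u (ρ y) y<F p , from′ A s u (ρ z) z<F q)
      (∃ᵈ (fresh 0) (fresh-pool 0 0<arity) (possibleᵈ (ρ y) y 10 (λ ()) ∧ᵈ possibleᵈ (ρ z) z 10 λ ()))))
      where
      to′ : ∀ A (s : Assignment A) u r {x} → x < F → let s′ = update A s (fresh 0) u in
        Blocks.Possible A (classes A s′) r (s′ x) (s′ (fresh 0)) → Blocks.Possible A (classes A s) r (s x) u
      to′ A s u r x<F = let open Sem A in transport A (s ⟨ fresh 0 ≔ u ⟩) s r (upd-≢ s u (+F-≢ {10} {0} λ ())) (upd-≢ s u (+F-≢ {10} {1} λ ()))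
        (upd-≢ s u (old-≢ 10 x<F)) (upd-≡ s (fresh 0) u)
      from′ : ∀ A (s : Assignment A) u r {x} → x < F → let s′ = update A s (fresh 0) u in
        Blocks.Possible A (classes A s) r (s x) u → Blocks.Possible A (classes A s′) r (s′ x) (s′ (fresh 0))
      from′ A s u r x<F = let open Sem A in transport A s (s ⟨ fresh 0 ≔ u ⟩) r (sym (upd-≢ s u (+F-≢ {10} {0} λ ()))) (sym (upd-≢ s u (+F-≢ {10} {1} λ ())))
        (sym (upd-≢ s u (old-≢ 10 x<F))) (sym (upd-≡ s (fresh 0) u))

    colouredᵈ : ∀ {B φ} (k : Skeleton B φ) ρ n → Bounded φ → Universals φ →
      Definable N (λ A s → Blocks.Coloured A k (classes A s) ρ n s) (depth B (strong-qr φ)) (Names (strong-bound φ))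
    colouredᵈ {B = B} (pos a) ρ n <F us = weaken ≤-refl (base≤depth B 0) id (witnessedᵈ (pos a) ρ (All.lookup <F))
    colouredᵈ {B = B} (neg a _) ρ n <F us = weaken ≤-refl (base≤depth B 0) id (witnessedᵈ (neg a) ρ (All.lookup <F))
    colouredᵈ {B = B} (neq y z) ρ n (y<F ∷ z<F ∷ []) us = weaken ≤-refl (base≤depth B 0) id (apartᵈ ρ y z y<F z<F)
    colouredᵈ {B = B} {α ∧ᶠ β} (both k l) ρ n <F (us , us′) =
      weaken ≤-refl (depth-mono B (m≤m⊔n (strong-qr α) _)) (names-mono ∈-++⁺ˡ) (colouredᵈ k ρ n (All.++⁻ˡ (vars α) <F) us) ∧ᵈ
      weaken ≤-refl (depth-mono B (m≤n⊔m (strong-qr α) _)) (names-mono (∈-++⁺ʳ (strong-bound α)))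
        (colouredᵈ l ρ (n + size α) (All.++⁻ʳ (vars α) <F) us′)
    colouredᵈ {B = B} {α ∨ᶠ β} (left k) ρ n <F (us , _) =
      weaken ≤-refl (depth-mono B (m≤m⊔n (strong-qr α) _)) (names-mono ∈-++⁺ˡ) (colouredᵈ k ρ n (All.++⁻ˡ (vars α) <F) us)
    colouredᵈ {B = B} {α ∨ᶠ β} (right k) ρ n <F (_ , us) =
      weaken ≤-refl (depth-mono B (m≤n⊔m (strong-qr α) _)) (names-mono (∈-++⁺ʳ (strong-bound α)))
        (colouredᵈ k ρ n (All.++⁻ʳ (vars α) <F) us)
    colouredᵈ {B = B} (weak x {φ} w k) ρ n (_ ∷ <F) us =
      weaken ≤-refl (depth-mono B (≤-reflexive (sym (strong-qr-weak w))))
        (names-mono (subst (_ ∈_) (sym (strong-bound-weak w)))) (colouredᵈ k (ρ [ x ≔ just n ]ᶜ) (suc n) <F us)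
    colouredᵈ {N} {B} (strong x {φ} ¬w k) ρ n (x<F ∷ <F) us =
      weaken ≤-refl (≤-trans (depth-strong x B (strong-qr φ)) (depth-mono B (≤-reflexive (sym (strong-qr-strong ¬w)))))
        (names-mono (subst (_ ∈_) (sym (strong-bound-strong ¬w))))
        (restate
          (λ A s _ (a , t) → a , subst id (same A s a) t) (λ A s _ (a , t) → a , subst id (sym (same A s a)) t)
          (∃ᵈ x (inj₁ (here refl)) (weaken ≤-refl ≤-refl (names-mono there) (colouredᵈ k (ρ [ x ≔ nothing ]ᶜ) n <F us))))
      where
      same : ∀ A s a → let s′ = update A s x a in
        Blocks.Coloured A k (classes A s′) (ρ [ x ≔ nothing ]ᶜ) n s′ ≡ Blocks.Coloured A k (classes A s) (ρ [ x ≔ nothing ]ᶜ) n s′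
      same A s a = let open Sem A in cong₂
        (λ a′ b′ → Blocks.Coloured A k (λ j → Class A (suc i) (suc (M + j)) a′ b′) (ρ [ x ≔ nothing ]ᶜ) n (s ⟨ x ≔ a ⟩))
        (upd-≢ s a (old-≢ 0 x<F ∘ sym)) (upd-≢ s a (old-≢ 1 x<F ∘ sym))
    -- With no strong quantifier above, no universal subformula is inner. Otherwise `depth` contains
    -- the charge and unfolds to `full`, which leaves two quantifiers for the parameters of the
    -- universal block.
    colouredᵈ {B = []}    (inner _ any) ρ n <F us with find any
    ... | _ , _ , ()
    colouredᵈ {B = _ ∷ _} (inner _ _) ρ n <F us = weaken z≤n ≤-refl id us
    colouredᵈ (outer _ _) ρ n <F us = ⊤ᵈ

  full-mono : ∀ {m n} → m ≤ n → full m ≤ full n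
  full-mono m≤n = +-monoʳ-≤ (2 + base) (*-monoʳ-≤ 3 m≤n)

  guardᵈ : ∀ {B φ} (k : Skeleton B φ) → Universals φ →
           Definable N (λ A s → Blocks.Guard A k s) (full (strong-qr φ)) (Names (strong-bound φ))
  guardᵈ (pos _)   us = ⊤ᵈ
  guardᵈ (neg _ _) us = ⊤ᵈ
  guardᵈ (neq _ _) us = ⊤ᵈ
  guardᵈ {φ = α ∧ᶠ β} (both k l) (us , us′) =
    weaken ≤-refl (full-mono (m≤m⊔n (strong-qr α) _)) (names-mono ∈-++⁺ˡ) (guardᵈ k us) ∧ᵈ
    weaken ≤-refl (full-mono (m≤n⊔m (strong-qr α) _)) (names-mono (∈-++⁺ʳ (strong-bound α))) (guardᵈ l us′)
  guardᵈ {φ = α ∨ᶠ β} (left k) (us , _) = weaken ≤-refl (full-mono (m≤m⊔n (strong-qr α) _)) (names-mono ∈-++⁺ˡ) (guardᵈ k us)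
  guardᵈ {φ = α ∨ᶠ β} (right k) (_ , us) =
    weaken ≤-refl (full-mono (m≤n⊔m (strong-qr α) _)) (names-mono (∈-++⁺ʳ (strong-bound α))) (guardᵈ k us)
  guardᵈ (weak x w k) us = weaken ≤-refl (full-mono (≤-reflexive (sym (strong-qr-weak w))))
    (names-mono (subst (_ ∈_) (sym (strong-bound-weak w)))) (guardᵈ k us)
  guardᵈ (strong x ¬w k) us = weaken ≤-refl (full-mono (≤-trans (n≤1+n _) (≤-reflexive (sym (strong-qr-strong ¬w)))))
    (names-mono (subst (_ ∈_) (sym (strong-bound-strong ¬w)) ∘ there)) (guardᵈ k us)
  guardᵈ (inner _ _) us = ⊤ᵈ
  guardᵈ (outer _ _) us = weaken z≤n ≤-refl id us

  module Block {φ : Formula τ} (p : NNF φ) (us : Universals φ) (<F : Bounded φ) where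

    M N₀ : ℕ
    M  = proj₁ (hashing (size φ))
    N₀ = proj₁ (proj₂ (hashing (size φ)))

    uncoloured : Colouring
    uncoloured _ = nothing

    Parametrised : Skeleton [] φ → ℕ → Property τ
    Parametrised k i A s =
      (∀ {j} → j < size φ → ∃[ u ] Colour.classes M i A s j u) × Blocks.Coloured A k (Colour.classes M i A s) uncoloured 0 s

    Realised : Property τ
    Realised A s = ∃[ k ] k ∈ skeletons [] p × Blocks.Guard A k s × ∃[ i ] i ∈ upTo M ×
      ∃[ a ] ∃[ b ] Parametrised k i A (update A (update A s F a) (suc F) b)

    realisedᵈ : Definable N₀ Realised (full (strong-qr φ)) (Names (strong-bound φ))
    -- The two parameters on top of `depth []` give exactly `full`, which the guard may also reach
    -- because it stands outside them.
    realisedᵈ = ⋁ᵈ (λ k → guardᵈ k us ∧ᵈ ⋁ᵈ (λ i → ∃ᵈ F (pool-10 0 (s≤s z≤n)) (∃ᵈ (suc F) (pool-10 1 (s≤s (s≤s z≤n)))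
      (weaken ≤-refl (≤-trans (m≤n+m 9 (arity τ)) (base≤depth [] (strong-qr φ))) id (∀<ᵈ (Colour.nonemptyᵈ M i) (size φ)) ∧ᵈ
       Colour.colouredᵈ M i k uncoloured 0 <F us))) (upTo M)) (skeletons [] p)

    module _ (A : Structure τ) where
      open Structure A
      open Sem A
      open Blocks A

      parameters : Assignment A → Universe → Universe → Assignment A
      parameters s a b = s ⟨ F ≔ a ⟩ ⟨ suc F ≔ b ⟩

      parameters-old : ∀ s a b {x} → x ∈ vars φ → parameters s a b x ≡ s x
      parameters-old s a b x∈ = trans (upd-≢ (s ⟨ F ≔ a ⟩) b (old-≢ 1 (All.lookup <F x∈))) (upd-≢ s a (old-≢ 0 (All.lookup <F x∈)))

      realised-sound : ∀ s → Realised A s → s ⊩ φ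
      realised-sound s (k , _ , g , i , _ , a , b , ne , t) =
        coincidence φ (λ x x∈ → parameters-old s a b (free⊆vars φ x∈))
          (Coloured-sound _ (parameters s a b) k ne (Guard-cong A k (λ x x∈ → sym (parameters-old s a b x∈)) g) t)

      realised-complete : ∀ s → N₀ ≤ last → s ⊩ φ → Realised A s
      realised-complete s N₀≤last h =
        let k , k∈ , sat = Sat-complete [] p h
            -- No colour is in use yet, so the initial witnesses are arbitrary.
            P = plan s k {uncoloured} {0} {s} (λ _ → element 0) (λ ()) (λ ()) (λ _ → refl) sat
            open Plan P
            i , i<M , a , b , f , fibre , sep = classes-exist A witness pairs
              (proj₂ (proj₂ (hashing (size φ))) last N₀≤last (rank ∘ witness) (mapˡ (Product.map rank rank) pairs)
                (≤-trans (≤-reflexive (length-map (Product.map rank rank) pairs)) few)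
                (All.map⁺ (All.map (λ u≢v → rank≤last _ , rank≤last _ , u≢v ∘ rank-injective) distinct)))
            C = λ a b j → Class A (suc i) (suc (M + j)) a b
            a≡ = trans (upd-≢ (s ⟨ F ≔ a ⟩) b (+F-≢ {1} {0} λ ())) (upd-≡ s F a)
            b≡ = upd-≡ (s ⟨ F ≔ a ⟩) (suc F) b
        in k , k∈ , guard , i , ∈-upTo⁺ i<M , a , b ,
           (λ {j} j< → witness j , subst₂ (λ a b → C a b j (witness j)) (sym a≡) (sym b≡) (from (fibre j<) refl)) ,
           Coloured-cong A k (λ x x∈ → sym (parameters-old s a b x∈))
             (subst₂ (λ a b → Coloured k (C a b) uncoloured 0 s) (sym a≡) (sym b≡) (realise (C a b) f fibre sep))

    large : Definable N₀ (λ A s → (A ⊨ s) φ) (full (strong-qr φ)) (Names (strong-bound φ))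
    large = restate (λ A s _ → realised-sound A s) (λ A s → realised-complete A s) realisedᵈ

    -- Numerals saturate at the last element, so these two are equal exactly when `last ≤ N₀`; the
    -- two cases are told apart without quantifiers.
    small : Formula τ
    small = atom (numeral N₀ ≐ numeral (suc N₀))

    module _ (A : Structure τ) (s : Assignment A) where
      open Structure A
      open Sem A

      small-sound : s ⊩ small → last ≤ N₀
      small-sound eq = ≮⇒≥ λ N₀<last → <⇒≢ (n<1+n N₀) (trans (sym (rank-element-≤ (<⇒≤ N₀<last)))
        (trans (cong rank (trans (sym (⟦numeral⟧ N₀ s)) (trans eq (⟦numeral⟧ (suc N₀) s)))) (rank-element-≤ N₀<last)))

      small-complete : last ≤ N₀ → s ⊩ small
      small-complete last≤ = trans (⟦numeral⟧ N₀ s) (trans (rank-injective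
        (trans (rank-element N₀) (trans (m≥n⇒m⊓n≡n last≤)
          (sym (trans (rank-element (suc N₀)) (m≥n⇒m⊓n≡n (m≤n⇒m≤1+n last≤))))))) (sym (⟦numeral⟧ (suc N₀) s)))

    elim : Elim φ
    elim = record
      { formula  = small ∧ᶠ inst ∨ᶠ ¬ᶠ small ∧ᶠ formula large
      ; sound    = λ A s _ →
          [ (λ (sm , h) → Sem.instantiate-sound A (small-sound A s sm) φ var h)
          , (λ (¬sm , h) → sound large A s (<⇒≤ (≰⇒> (¬sm ∘ small-complete A s))) h) ]′
      ; complete = λ A s _ h → decide A s h (Structure.last A ≤? N₀)
      ; qr≤      = subst (λ n → n ⊔ qr (formula large) ≤ full (strong-qr φ)) (sym (proj₁ qf)) (qr≤ large)
      ; bound⊆   = λ {x} x∈ → bound⊆ large (subst (λ ys → x ∈ ys ++ bound (formula large)) (proj₂ qf) x∈)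
      }
      where
      inst : Formula τ
      inst = instantiate N₀ var φ
      qf = instantiate-quantifierFree N₀ var φ
      decide : ∀ A s → (A ⊨ s) φ → Dec (Structure.last A ≤ N₀) → (A ⊨ s) (small ∧ᶠ inst ∨ᶠ ¬ᶠ small ∧ᶠ formula large)
      decide A s h (yes last≤) = inj₁ (small-complete A s last≤ , Sem.instantiate-complete A last≤ φ var h)
      decide A s h (no last≰)  = inj₂ (last≰ ∘ small-sound A s , complete large A s (<⇒≤ (≰⇒> last≰)) h)

  -- Induction over alternating blocks

  open Block using (elim)

  -- A universal subformula is eliminated through its dual, which is not a structural part of it. So
  -- the recursion runs over `NNF φ` and provides for `φ` and `dual φ` side by side.
  universals : ∀ {φ} → NNF φ → Bounded φ → Universals φ
  universals-dual : ∀ {φ} → NNF φ → Bounded φ → Universals (dual φ)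
  elim-universal : ∀ {x φ} → NNF φ → Universals (dual φ) → Bounded (∀ᶠ x φ) → Elim (∀ᶠ x φ)
  universals (pos a)  _ = _
  universals (neg a)  _ = _
  universals {φ ∧ᶠ ψ} (p ∧ᶠ q) <F = universals p (All.++⁻ˡ (vars φ) <F) , universals q (All.++⁻ʳ (vars φ) <F)
  universals {φ ∨ᶠ ψ} (p ∨ᶠ q) <F = universals p (All.++⁻ˡ (vars φ) <F) , universals q (All.++⁻ʳ (vars φ) <F)
  universals (∃ᶠ x p) (_ ∷ <F) = universals p <F
  universals (∀ᶠ x p) <F@(_ ∷ <F′) = elim-universal p (universals-dual p <F′) <F
  universals-dual (pos a) _ = _
  universals-dual (neg a) _ = _
  universals-dual {φ ∧ᶠ ψ} (p ∧ᶠ q) <F = universals-dual p (All.++⁻ˡ (vars φ) <F) , universals-dual q (All.++⁻ʳ (vars φ) <F)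
  universals-dual {φ ∨ᶠ ψ} (p ∨ᶠ q) <F = universals-dual p (All.++⁻ˡ (vars φ) <F) , universals-dual q (All.++⁻ʳ (vars φ) <F)
  universals-dual {∃ᶠ x φ} (∃ᶠ x p) <F@(_ ∷ <F′) = elim-universal (NNF-dual p)
    (subst Universals (sym (dual-involutive p)) (universals p <F′)) (subst (All (_< F)) (sym (vars-dual (∃ᶠ x φ))) <F)
  universals-dual (∀ᶠ x p) (_ ∷ <F) = universals-dual p <F
  elim-universal {x} {φ} p us <F = weaken ≤-refl (full-mono (≤-reflexive (strong-qr-dual (∀ᶠ x p))))
    (names-mono (subst (_ ∈_) (strong-bound-dual (∀ᶠ x p))))
    (restate
      (λ A s _ h → let open Sem A in decidable-stable (⊩? (∀ᶠ x φ) s) (h ∘ dual-complete (∀ᶠ x φ)))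
      (λ A s _ h d → Sem.dual-sound A (∀ᶠ x φ) d h)
      (¬ᵈ elim (NNF-dual (∀ᶠ x p)) us (subst (All (_< F)) (sym (vars-dual (∀ᶠ x φ))) <F)))

  elimination : ∀ {φ} → NNF φ → Bounded φ → Elim φ
  elimination p <F = elim p (universals p <F) <F

-- Counting of names

module _ {a} {X : Set a} where

  ∈-removeAt : ∀ {x y : X} {ys} (x∈ : x ∈ ys) → y ∈ ys → y ≢ x → y ∈ removeAt ys (Any.index x∈)
  ∈-removeAt (here refl) (here refl) y≢x = contradiction refl y≢x
  ∈-removeAt (here refl) (there y∈)  y≢x = y∈
  ∈-removeAt (there x∈)  (here refl) y≢x = here refl
  ∈-removeAt (there x∈)  (there y∈)  y≢x = there (∈-removeAt x∈ y∈ y≢x)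

  -- Each element of `xs` strikes one entry off `ys`, and distinctness keeps the entries for the
  -- others.
  Unique-length : ∀ {xs ys : List X} → Unique xs → (∀ {x} → x ∈ xs → x ∈ ys) → length xs ≤ length ys
  Unique-length []       xs⊆ys = z≤n
  Unique-length {x ∷ xs} {ys} (x∉ ∷ u) xs⊆ys = ≤-trans
    (s≤s (Unique-length u λ y∈ → ∈-removeAt (xs⊆ys (here refl)) (xs⊆ys (there y∈)) (All.lookup x∉ y∈ ∘ sym)))
    (≤-reflexive (sym (length-removeAt′ ys (Any.index (xs⊆ys (here refl))))))

∣∣-mono : ∀ xs ys zs → (∀ {x} → x ∈ xs → x ∈ ys ⊎ x ∈ zs) → ∣ xs ∣ ≤ ∣ ys ∣ + length zs
∣∣-mono xs ys zs xs⊆ = ≤-trans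
  (Unique-length (deduplicate-! xs) λ x∈ → [ ∈-++⁺ˡ ∘ ∈-deduplicate⁺ _≟_ , ∈-++⁺ʳ (deduplicate _≟_ ys) ]′
    (xs⊆ (∈-deduplicate⁻ _≟_ xs x∈)))
  (≤-reflexive (length-++ (deduplicate _≟_ ys)))

-- Padding to exact equations

module Padding {τ : Signature} (φ : Formula τ) (F : ℕ) (eliminated : Elimination.Elim {τ} F φ) where

  open Elimination {τ} F

  σ : ℕ
  σ = strong-qr φ

  core : Formula τ
  core = formula eliminated

  -- The equations for qr and bound are exact, so the eliminated formula is padded from below.
  dummies : ℕ → Formula τ
  dummies zero    = ⊤ᶠ
  dummies (suc n) = ∃ᶠ F (dummies n)

  -- Strong names that the eliminated formula does not bind would be missing from the count, so each
  -- is bound here once more.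
  dummyFor : List Var → Formula τ
  dummyFor []       = ⊤ᶠ
  dummyFor (x ∷ xs) = ∃ᶠ x ⊤ᶠ ∧ᶠ dummyFor xs

  φ′ : Formula τ
  φ′ = core ∧ᶠ dummies (3 * σ) ∧ᶠ dummyFor (strong-bound φ)

  equivalent : Equivalent φ′ φ
  equivalent A s = mk⇔ (λ (h , _) → sound eliminated A s z≤n h)
    (λ h → complete eliminated A s z≤n h , dummies-hold (3 * σ) s , dummyFor-holds (strong-bound φ))
    where
    open Sem A
    dummies-hold : ∀ n s → s ⊩ dummies n
    dummies-hold zero    s = refl
    dummies-hold (suc n) s = element 0 , dummies-hold n _
    dummyFor-holds : ∀ xs → s ⊩ dummyFor xs
    dummyFor-holds []       = refl
    dummyFor-holds (x ∷ xs) = (element 0 , refl) , dummyFor-holds xs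

  qr-dummies : ∀ n → qr (dummies n) ≡ n
  qr-dummies zero    = refl
  qr-dummies (suc n) = cong suc (qr-dummies n)

  qr-dummyFor : ∀ xs → qr (dummyFor xs) ≤ 1
  qr-dummyFor []       = z≤n
  qr-dummyFor (x ∷ xs) = ⊔-lub ≤-refl (qr-dummyFor xs)

  bound-dummies : ∀ n {x} → x ∈ bound (dummies n) → x ≡ F
  bound-dummies (suc n) (here x≡F) = x≡F
  bound-dummies (suc n) (there x∈) = bound-dummies n x∈

  bound-dummyFor : ∀ xs → bound (dummyFor xs) ≡ xs
  bound-dummyFor []       = refl
  bound-dummyFor (x ∷ xs) = cong (x ∷_) (bound-dummyFor xs)

  qr-lower : 3 * σ ≤ qr φ′
  qr-lower = begin
    3 * σ                                                      ≡⟨ qr-dummies (3 * σ) ⟨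
    qr (dummies (3 * σ))                                       ≤⟨ m≤m⊔n (qr (dummies (3 * σ))) (qr (dummyFor (strong-bound φ))) ⟩
    qr (dummies (3 * σ)) ⊔ qr (dummyFor (strong-bound φ))      ≤⟨ m≤n⊔m (qr core) _ ⟩
    qr φ′                                                      ∎
    where open ≤-Reasoning

  qr-upper : qr φ′ ≤ 3 * σ + (11 + arity τ)
  qr-upper = ⊔-lub (≤-trans (qr≤ eliminated) (≤-reflexive (shift (arity τ) (3 * σ))))
    (⊔-lub (≤-trans (≤-reflexive (qr-dummies (3 * σ))) (m≤m+n (3 * σ) (11 + arity τ)))
           (≤-trans (qr-dummyFor (strong-bound φ)) (≤-trans (s≤s z≤n) (m≤n+m (11 + arity τ) (3 * σ)))))
    where
    shift : ∀ a q → 2 + (a + 9) + q ≡ q + (11 + a)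
    shift = solve-∀

  poolVars : List Var
  poolVars = mapˡ (_+ F) (upTo (10 + arity τ))

  ∈-poolVars : ∀ {x} → InPool x → x ∈ poolVars
  ∈-poolVars {x} (F≤x , x<) = subst (_∈ poolVars) (m∸n+n≡m F≤x) (∈-map⁺ (_+ F) (∈-upTo⁺
    (+-cancelʳ-< F (x ∸ F) (10 + arity τ) (subst (_< 10 + arity τ + F) (sym (m∸n+n≡m F≤x)) x<))))

  names : ∀ {x} → x ∈ bound φ′ → Names (strong-bound φ) x
  names x∈ with ∈-++⁻ (bound core) x∈
  ... | inj₁ x∈core = bound⊆ eliminated x∈core
  ... | inj₂ x∈pad with ∈-++⁻ (bound (dummies (3 * σ))) x∈pad
  -- The padding variable `F` is the name of the first parameter, hence already in the pool.
  ...   | inj₁ x∈dummies rewrite bound-dummies (3 * σ) x∈dummies = pool-10 0 (s≤s z≤n)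
  ...   | inj₂ x∈dummy = inj₁ (subst (_ ∈_) (bound-dummyFor (strong-bound φ)) x∈dummy)

  bound-lower : ∣ strong-bound φ ∣ ≤ ∣ bound φ′ ∣
  bound-lower = ≤-trans (∣∣-mono (strong-bound φ) (bound φ′) [] λ {x} x∈ → inj₁
    (∈-++⁺ʳ (bound core) (∈-++⁺ʳ (bound (dummies (3 * σ))) (subst (x ∈_) (sym (bound-dummyFor (strong-bound φ))) x∈))))
    (≤-reflexive (+-identityʳ ∣ bound φ′ ∣))

  bound-upper : ∣ bound φ′ ∣ ≤ ∣ strong-bound φ ∣ + (11 + arity τ)
  bound-upper = begin
    ∣ bound φ′ ∣                             ≤⟨ ∣∣-mono (bound φ′) (strong-bound φ) poolVars (Sum.map₂ ∈-poolVars ∘ names) ⟩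
    ∣ strong-bound φ ∣ + length poolVars     ≡⟨ cong (∣ strong-bound φ ∣ +_) (trans (length-map (_+ F) (upTo (10 + arity τ))) (length-upTo (10 + arity τ))) ⟩
    ∣ strong-bound φ ∣ + (10 + arity τ)      ≤⟨ +-monoʳ-≤ ∣ strong-bound φ ∣ (n≤1+n (10 + arity τ)) ⟩
    ∣ strong-bound φ ∣ + (11 + arity τ)      ∎
    where open ≤-Reasoning

excess : ∀ a {m n} → m ≤ n → n ≤ m + (11 + a) → ∃[ r ] (r ≤ 11 * a + 11 × n ≡ m + r)
excess a {m} {n} m≤n n≤ = n ∸ m ,
  ≤-trans (m≤n+o⇒m∸n≤o n m n≤) (≤-trans (≤-reflexive (+-comm 11 a)) (+-monoˡ-≤ 11 (m≤m+n a (10 * a)))) ,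
  sym (m+[n∸m]≡n m≤n)

theorem3p6 : ∃[ c ] ((τ : Signature) (φ : Formula τ) → NNF φ →
    ∃[ φ′ ] ( Equivalent φ′ φ
    × (∃[ r ] (r ≤ c * arity τ + c × qr φ′ ≡ 3 * strong-qr φ + r))
    × (∃[ r ] (r ≤ c * arity τ + c × ∣ bound φ′ ∣ ≡ ∣ strong-bound φ ∣ + r))))
-- For the rank, 11 = 2 + 9: the two parameters and the part of `base` beyond `arity τ`. The pool
-- has `10 + arity τ` names and stays within the same bound.
theorem3p6 = 11 , λ τ φ p →
  let F = suc (max 0 (vars φ))
      open Padding φ F (Elimination.elimination F p (All.map s≤s (xs≤max 0 (vars φ))))
  in φ′ , equivalent , excess (arity τ) qr-lower qr-upper , excess (arity τ) bound-lower bound-upper
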